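{- There is a constant $C$ such that the following holds. If $A=\{a_1\le a_2\le a_3\le\dots\}$ is an infinite non-decreasing sequence of positive integers (repetitions allowed) and $A(n)\ge Cn$ for all sufficiently large $n$, then $A$ is subcomplete.
   Context: $A(n)$ denotes the number of terms of the sequence $A$ (counted with multiplicity) that lie between $1$ and $n$. For a sequence $A$, $S_A$ is the set of all sums $\sum_{i\in I} a_i$ over finite sets $I$ of indices. $A$ is subcomplete if $S_A$ contains an infinite arithmetic progression. -}

module Defs where

open import Data.Nat using (ℕ; zero; suc; _+_; _*_; _≤_; _<_; _≤ᵇ_)
open import Data.Bool using (Bool; true; false; if_then_else_)
open import Data.Product using (Σ; ∃; ∃-syntax; _×_)
open import Relation.Binary.PropositionalEquality using (_≡_)

-- A sequence of positive integers a₁ ≤ a₂ ≤ … is modelled as a : ℕ → ℕ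
-- (0-indexed: a 0 is a₁).

Positive : (ℕ → ℕ) → Set
Positive a = ∀ i → 1 ≤ a i

NonDecreasing : (ℕ → ℕ) → Set
NonDecreasing a = ∀ i j → i ≤ j → a i ≤ a j

countBelow : (ℕ → ℕ) → ℕ → ℕ → ℕ
countBelow a n zero    = 0
countBelow a n (suc N) = (if a N ≤ᵇ n then 1 else 0) + countBelow a n N

-- "A(n) ≥ k": at least k terms (with multiplicity) lie in [1, n].
-- Stated via finite prefixes so that it also makes sense when A(n) is infinite.
CountingAtLeast : (ℕ → ℕ) → ℕ → ℕ → Set
CountingAtLeast a n k = ∃[ N ] k ≤ countBelow a n N

subsetSum : (ℕ → ℕ) → (ℕ → Bool) → ℕ → ℕ
subsetSum a I zero    = 0
subsetSum a I (suc N) = (if I N then a N else 0) + subsetSum a I N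

-- x ∈ S_A: x is the sum of a_i over a finite set of indices
-- (a finite set of indices = a Boolean indicator restricted to some range [0, N)).
InSubsetSums : (ℕ → ℕ) → ℕ → Set
InSubsetSums a x = ∃[ N ] ∃[ I ] subsetSum a I N ≡ x

Subcomplete : (ℕ → ℕ) → Set
Subcomplete a = ∃[ b ] ∃[ d ] (1 ≤ d × (∀ k → InSubsetSums a (b + k * d)))

{-# OPTIONS --safe #-}
module Submission where

-- Choose u = 2^i minimal such that a(2F·2^j) ≤ 2^j for all j ≥ i.  Then the terms with index in
-- [Fu, 2Fu) lie in (u/2, u].  Let q be the most frequent of their values, t its multiplicity
-- (divided by 16), and let W j be the set of values of multiplicity > j (again divided by 16),
-- which are distinct modulo q.  The sumsets S i = W 0 + ⋯ + W (i − 1) modulo q cannot all grow by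
-- a constant fraction of |W i|, since ∑ |W j| is large compared with q.  At a step of slow growth,
-- loss z = |(S i) ∖ (S i − z)| is small on W i; it is subadditive and symmetric in z, so counting its
-- sublevel sets gives one, B, that is stable under W i and so large that some translate of S i
-- contains more than half of B.  Hence S i + S i contains a translate of the stabiliser of B, and
-- therefore all multiples of some d ≤ t modulo q.  Adding copies of q turns these residues into a
-- progression of length 4u with difference d ≤ 2u in the subset sums of the block.
--
-- The later terms are absorbed one by one: among any d of them some have a sum divisible by d, which
-- lengthens the progression as long as that sum is at most d times the current length.

open import Defs
open import Data.Bool using (Bool; true; false; if_then_else_; _∧_; not; T)
open import Data.Empty using (⊥-elim)
open import Data.Fin using (Fin; toℕ; fromℕ<)
open import Data.Fin.Properties using (pigeonhole; toℕ<n; toℕ-fromℕ<)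
open import Data.List using (List; []; _∷_; _++_; length; take; drop; applyDownFrom)
open import Data.List.Properties using (take++drop≡id; length-++; length-take; length-drop; ++-assoc)
open import Data.List.Relation.Binary.Permutation.Propositional as Perm
  using (_↭_; refl; prep; swap; ↭-sym; ↭-trans; ↭-reflexive)
import Data.List.Relation.Binary.Permutation.Propositional.Properties as ↭
open import Data.List.Relation.Unary.All as All using (All; []; _∷_)
open import Data.List.Relation.Unary.All.Properties using (++⁺; ++⁻)
open import Data.Nat
open import Data.Nat.DivMod
open import Data.Nat.ListAction using (sum)
open import Data.Nat.ListAction.Properties using (sum-++)
open import Data.Nat.Properties
open import Data.Nat.Tactic.RingSolver using (solve-∀)
open import Data.Product using (∃; ∃-syntax; _×_; _,_; proj₁; proj₂)
open import Data.Sum using (_⊎_; inj₁; inj₂)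
open import Data.Unit using (tt)
open import Function using (_∘_)
open import Relation.Binary.PropositionalEquality
open import Relation.Nullary using (¬_; yes; no; contradiction)
open import Relation.Nullary.Decidable using (_×-dec_; from-yes)
open import Algebra.Properties.CommutativeSemigroup +-commutativeSemigroup using (x∙yz≈y∙xz)

⟦_⟧ : Bool → ℕ
⟦ b ⟧ = if b then 1 else 0

-- Finite sums

∑ : ℕ → (ℕ → ℕ) → ℕ
∑ zero    f = 0
∑ (suc n) f = f n + ∑ n f

T⇒1≤⟦⟧ : ∀ {b} → T b → 1 ≤ ⟦ b ⟧
T⇒1≤⟦⟧ {true} _ = ≤-refl

0<⟦⟧⇒T : ∀ {b} → 0 < ⟦ b ⟧ → T b
0<⟦⟧⇒T {true} _ = tt

⟦⟧-mono : ∀ {b c} → (T b → T c) → ⟦ b ⟧ ≤ ⟦ c ⟧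
⟦⟧-mono {false}        _ = z≤n
⟦⟧-mono {true} {true}  _ = ≤-refl
⟦⟧-mono {true} {false} f = ⊥-elim (f tt)

⟦⟧≤1 : ∀ b → ⟦ b ⟧ ≤ 1
⟦⟧≤1 false = z≤n
⟦⟧≤1 true  = ≤-refl

T-∧⁺ : ∀ {b c} → T b → T c → T (b ∧ c)
T-∧⁺ {true} _ c = c

T-∧⁻ : ∀ {b c} → T (b ∧ c) → T b × T c
T-∧⁻ {true} c = tt , c

∑-mono : ∀ n {f g} → (∀ i → i < n → f i ≤ g i) → ∑ n f ≤ ∑ n g
∑-mono zero    _   = z≤n
∑-mono (suc n) f≤g = +-mono-≤ (f≤g n ≤-refl) (∑-mono n λ i i<n → f≤g i (m<n⇒m<1+n i<n))

∑-cong : ∀ n {f g} → (∀ i → f i ≡ g i) → ∑ n f ≡ ∑ n g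
∑-cong zero    _   = refl
∑-cong (suc n) f≡g = cong₂ _+_ (f≡g n) (∑-cong n f≡g)

∑-+ : ∀ n f g → ∑ n (λ i → f i + g i) ≡ ∑ n f + ∑ n g
∑-+ zero    f g = refl
∑-+ (suc n) f g rewrite ∑-+ n f g = interchange (f n) (g n) (∑ n f) (∑ n g)
  where
  interchange : ∀ a b c d → a + b + (c + d) ≡ a + c + (b + d)
  interchange = solve-∀

∑-* : ∀ n c f → ∑ n (λ i → c * f i) ≡ c * ∑ n f
∑-* zero    c f = sym (*-zeroʳ c)
∑-* (suc n) c f rewrite ∑-* n c f = sym (*-distribˡ-+ c (f n) (∑ n f))

∑-const : ∀ n c → ∑ n (λ _ → c) ≡ n * c
∑-const zero    c = refl
∑-const (suc n) c = cong (c +_) (∑-const n c)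

∑-zero : ∀ n {f} → (∀ i → i < n → f i ≡ 0) → ∑ n f ≡ 0
∑-zero zero    _   = refl
∑-zero (suc n) f≡0 = cong₂ _+_ (f≡0 n ≤-refl) (∑-zero n λ i i<n → f≡0 i (m<n⇒m<1+n i<n))

∑-swap : ∀ m n (f : ℕ → ℕ → ℕ) → ∑ m (λ i → ∑ n (f i)) ≡ ∑ n (λ j → ∑ m (λ i → f i j))
∑-swap zero    n f = sym (∑-zero n λ _ _ → refl)
∑-swap (suc m) n f = trans (cong (∑ n (f m) +_) (∑-swap m n f)) (sym (∑-+ n (f m) _))

∑-<⇒∃ : ∀ n {f g} → ∑ n f < ∑ n g → ∃ λ i → i < n × f i < g i
∑-<⇒∃ (suc n) {f} {g} lt with f n <? g n
... | yes fn<gn = n , ≤-refl , fn<gn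
... | no  fn≮gn =
  let i , i<n , fi<gi = ∑-<⇒∃ n (+-cancelˡ-< (f n) _ _
        (<-≤-trans lt (+-monoˡ-≤ (∑ n g) (≮⇒≥ fn≮gn))))
  in  i , m<n⇒m<1+n i<n , fi<gi

∑-positive : ∀ n {f} → 0 < ∑ n f → ∃ λ i → i < n × 0 < f i
∑-positive n {f} 0<∑ = ∑-<⇒∃ n (subst (_< ∑ n f) (sym (∑-zero n λ _ _ → refl)) 0<∑)

term≤∑ : ∀ n f {i} → i < n → f i ≤ ∑ n f
term≤∑ (suc n) f {i} i<1+n with m≤n⇒m<n∨m≡n (s≤s⁻¹ i<1+n)
... | inj₁ i<n  = ≤-trans (term≤∑ n f i<n) (m≤n+m _ _)
... | inj₂ refl = m≤m+n _ _

-- Pigeonhole for indicators. It later produces two stabilising residues in one short window.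
two-terms : ∀ n f → (∀ i → f i ≤ 1) → 1 < ∑ n f →
            ∃ λ i → ∃ λ j → i < j × j < n × 0 < f i × 0 < f j
two-terms (suc n) f f≤1 1<∑ with f n in eq
... | zero  = let i , j , i<j , j<n , rest = two-terms n f f≤1 1<∑
              in  i , j , i<j , m<n⇒m<1+n j<n , rest
... | suc k = let i , i<n , 0<fi = ∑-positive n (s<s⁻¹ (≤-trans 1<∑ (+-monoˡ-≤ (∑ n f) (subst (_≤ 1) eq (f≤1 n)))))
              in  i , n , i<n , ≤-refl , 0<fi , subst (0 <_) (sym eq) z<s

∑-head : ∀ n f → ∑ (suc n) f ≡ f 0 + ∑ n (f ∘ suc)
∑-head zero    f = refl
∑-head (suc n) f = trans (cong (f (suc n) +_) (∑-head n f)) (x∙yz≈y∙xz (f (suc n)) (f 0) _)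

∑-reverse : ∀ n (f : ℕ → ℕ) → ∑ n (λ i → f (n ∸ i)) ≡ ∑ n (f ∘ suc)
∑-reverse zero    f = refl
∑-reverse (suc n) f = trans (∑-head n (λ i → f (suc n ∸ i))) (cong (f (suc n) +_) (∑-reverse n f))

-- Periodic functions and sums over a full period

Periodic : ℕ → {A : Set} → (ℕ → A) → Set
Periodic q f = ∀ x → f (q + x) ≡ f x

periodic-* : ∀ {q} {A : Set} {f : ℕ → A} → Periodic q f → ∀ k x → f (k * q + x) ≡ f x
periodic-* f-per zero x = refl
periodic-* {q} {f = f} f-per (suc k) x =
  trans (cong f (+-assoc q (k * q) x)) (trans (f-per (k * q + x)) (periodic-* f-per k x))

periodic-% : ∀ {q} .{{_ : NonZero q}} {A : Set} {f : ℕ → A} → Periodic q f → ∀ z → f (z % q) ≡ f z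
periodic-% {q} {f = f} f-per z = sym (trans (cong f (trans (m≡m%n+[m/n]*n z q) (+-comm (z % q) _)))
  (periodic-* f-per (z / q) (z % q)))

∑-shift : ∀ {q f} → Periodic q f → ∀ k → ∑ q (λ x → f (k + x)) ≡ ∑ q f
∑-shift         f-per zero    = refl
∑-shift {q} {f} f-per (suc k) = trans (∑-shift {f = f ∘ suc} suc-per k) shift₁
  where
  suc-per : Periodic q (f ∘ suc)
  suc-per x = trans (cong f (sym (+-suc q x))) (f-per (suc x))
  shift₁ : ∑ q (f ∘ suc) ≡ ∑ q f
  shift₁ = +-cancelˡ-≡ (f 0) _ _ (trans (sym (∑-head q f))
    (cong (_+ ∑ q f) (trans (cong f (sym (+-identityʳ q))) (f-per 0))))

-- For `x` in `[0, q)` the number `q ∸ x` takes the values `q, …, 1`, so the arguments fill the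
-- period that starts at `suc k`.
∑-reflect : ∀ {q f} → Periodic q f → ∀ k → ∑ q (λ x → f (k + (q ∸ x))) ≡ ∑ q f
∑-reflect {q} {f} f-per k = trans (∑-reverse q (λ x → f (k + x)))
  (trans (∑-cong q (λ x → cong f (+-suc k x))) (∑-shift {f = f} f-per (suc k)))

-- Translates of a set of residues

card : ℕ → (ℕ → Bool) → ℕ
card n b = ∑ n λ x → ⟦ b x ⟧

card≤ : ∀ n b → card n b ≤ n
card≤ n b = subst (card n b ≤_) (trans (∑-const n 1) (*-identityʳ n)) (∑-mono n λ x _ → ⟦⟧≤1 (b x))

module Loss (q : ℕ) .{{_ : NonZero q}} (S : ℕ → Bool) (S-per : Periodic q S) where

  size : ℕ
  size = card q S

  loss : ℕ → ℕ
  loss z = ∑ q λ x → ⟦ S x ∧ not (S (z + x)) ⟧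

  loss-periodic : Periodic q loss
  loss-periodic z = ∑-cong q λ x →
    cong (λ b → ⟦ S x ∧ not b ⟧) (trans (cong S (+-assoc q z x)) (S-per (z + x)))

  private
    translated : ∀ w → Periodic q (λ x → ⟦ S x ∧ not (S (w + x)) ⟧)
    translated w x = cong₂ (λ b c → ⟦ b ∧ not c ⟧) (S-per x)
      (trans (cong S (x∙yz≈y∙xz w q x)) (S-per (w + x)))

  loss-zero : loss 0 ≡ 0
  loss-zero = ∑-zero q λ x _ → cancel (S x)
    where
    cancel : ∀ b → ⟦ b ∧ not b ⟧ ≡ 0
    cancel false = refl
    cancel true  = refl

  -- An `x` that `z + w` carries out of `S` is either carried out by `z`, or `z + x` is still in `S`
  -- and is carried out by `w`. The second kind is counted by `loss w` after a shift by `z`.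
  loss-+ : ∀ z w → loss (z + w) ≤ loss z + loss w
  loss-+ z w = begin
    loss (z + w)
      ≤⟨ ∑-mono q (λ x _ → subst (λ y → ⟦ S x ∧ not (S y) ⟧
             ≤ ⟦ S x ∧ not (S (z + x)) ⟧ + ⟦ S (z + x) ∧ not (S (w + (z + x))) ⟧)
             (reorder w z x) (via (S x) (S (z + x)) (S (w + (z + x))))) ⟩
    ∑ q (λ x → ⟦ S x ∧ not (S (z + x)) ⟧ + ⟦ S (z + x) ∧ not (S (w + (z + x))) ⟧)
      ≡⟨ ∑-+ q _ _ ⟩
    loss z + ∑ q (λ x → ⟦ S (z + x) ∧ not (S (w + (z + x))) ⟧)
      ≡⟨ cong (loss z +_) (∑-shift (translated w) z) ⟩
    loss z + loss w ∎
    where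
    open ≤-Reasoning
    reorder : ∀ a b c → a + (b + c) ≡ b + a + c
    reorder = solve-∀
    via : ∀ a b c → ⟦ a ∧ not c ⟧ ≤ ⟦ a ∧ not b ⟧ + ⟦ b ∧ not c ⟧
    via false _     _     = z≤n
    via true  false false = s≤s z≤n
    via true  false true  = z≤n
    via true  true  false = s≤s z≤n
    via true  true  true  = z≤n

  -- `S` and its translate by `−z` have the same size, so each exceeds the intersection `both` by
  -- the same number.
  loss-neg : ∀ z w k → z + w ≡ k * q → loss w ≡ loss z
  loss-neg z w k z+w≡kq = +-cancelʳ-≡ both _ _ (trans left (sym right))
    where
    both = ∑ q λ x → ⟦ S x ∧ S (z + x) ⟧
    split : ∀ b c → ⟦ b ∧ not c ⟧ + ⟦ c ∧ b ⟧ ≡ ⟦ b ⟧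
    split false false = refl
    split false true  = refl
    split true  false = refl
    split true  true  = refl
    split′ : ∀ b c → ⟦ b ∧ not c ⟧ + ⟦ b ∧ c ⟧ ≡ ⟦ b ⟧
    split′ false _     = refl
    split′ true  false = refl
    split′ true  true  = refl
    back : ∀ x → S (w + (z + x)) ≡ S x
    back x = trans (cong S (trans (reorder w z x) (cong (_+ x) z+w≡kq))) (periodic-* S-per k x)
      where
      reorder : ∀ a b c → a + (b + c) ≡ b + a + c
      reorder = solve-∀
    right : loss z + both ≡ size
    right = trans (sym (∑-+ q _ _)) (∑-cong q λ x → split′ (S x) (S (z + x)))
    left : loss w + both ≡ size
    left = trans (cong (_+ both) (sym (∑-shift (translated w) z)))
      (trans (sym (∑-+ q _ _))
      (trans (∑-cong q λ x → trans (cong (λ b → ⟦ S (z + x) ∧ not b ⟧ + ⟦ S x ∧ S (z + x) ⟧) (back x)) (split (S (z + x)) (S x)))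
             (∑-shift (λ x → cong ⟦_⟧ (S-per x)) z)))

  neg : ℕ → ℕ
  neg w = pred q * w

  +-neg : ∀ w → w + neg w ≡ w * q
  +-neg w = trans (cong (_* w) (suc-pred q)) (*-comm q w)

  -- Reverse triangle inequality: subadditivity for `z = (z + w) − w`, combined with symmetry.
  loss-+ʳ : ∀ z w → loss z ≤ loss (z + w) + loss w
  loss-+ʳ z w = begin
    loss z                       ≡⟨ periodic-* loss-periodic w z ⟨
    loss (w * q + z)             ≡⟨ cong loss (trans (cong (_+ z) (sym (+-neg w))) (reorder z w (neg w))) ⟩
    loss (z + w + neg w)         ≤⟨ loss-+ (z + w) (neg w) ⟩
    loss (z + w) + loss (neg w)  ≡⟨ cong (loss (z + w) +_) (loss-neg w (neg w) w (+-neg w)) ⟩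
    loss (z + w) + loss w        ∎
    where
    open ≤-Reasoning
    reorder : ∀ a b c → b + c + a ≡ a + b + c
    reorder = solve-∀

  loss-* : ∀ d → loss d ≡ 0 → ∀ k → loss (k * d) ≡ 0
  loss-* d loss-d≡0 zero    = loss-zero
  loss-* d loss-d≡0 (suc k) = n≤0⇒n≡0 (subst (loss (d + k * d) ≤_)
    (cong₂ _+_ loss-d≡0 (loss-* d loss-d≡0 k)) (loss-+ d (k * d)))

  closed⇒loss≡0 : ∀ g → (∀ x → T (S x) → T (S (g + x))) → loss g ≡ 0
  closed⇒loss≡0 g closed = ∑-zero q λ x _ → none (S x) (S (g + x)) (closed x)
    where
    none : ∀ b c → (T b → T c) → ⟦ b ∧ not c ⟧ ≡ 0
    none false _     _   = refl
    none true  true  _   = refl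
    none true  false b⇒c = ⊥-elim (b⇒c tt)

  loss≡0⇒closed : ∀ g → loss g ≡ 0 → ∀ x → T (S x) → T (S (g + x))
  loss≡0⇒closed g loss≡0 x Sx =
    subst T (periodic-% shifted x) (all (S (x % q)) (S (g + x % q)) (subst T (sym (periodic-% S-per x)) Sx)
      (≤-trans (term≤∑ q (λ y → ⟦ S y ∧ not (S (g + y)) ⟧) (m%n<n x q)) (≤-reflexive loss≡0)))
    where
    all : ∀ b c → T b → ⟦ b ∧ not c ⟧ ≤ 0 → T c
    all true true _ _ = tt
    shifted : Periodic q (λ y → S (g + y))
    shifted y = trans (cong S (x∙yz≈y∙xz g q y)) (S-per (g + y))

module Translates (q : ℕ) .{{_ : NonZero q}} (S : ℕ → Bool) (S-per : Periodic q S) where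
  open Loss q S S-per

  -- Double counting of the pairs `(x, z)` with `x` in `S`, `z` in `B` and `z + x` outside `S`. Each
  -- `z` lies in `loss z ≤ η` of them, which makes fewer than `size * card q B / 2` in all, so some
  -- `x` in `S` lies in fewer than `card q B / 2`.
  majority : ∀ η (B : ℕ → Bool) → (∀ z → T (B z) → loss z ≤ η) → 0 < card q B → 2 * η < size →
             ∃ λ x → x < q × T (S x) × card q B < 2 * card q (λ z → B z ∧ S (z + x))
  majority η B B-loss 0<B 2η<size =
    let x , x<q , lt = ∑-<⇒∃ q {λ x → ⟦ S x ⟧ * (2 * misses x)} {λ x → ⟦ S x ⟧ * card q B} average
        Sx , few = cancel (S x) lt
    in  x , x<q , Sx , +-cancelˡ-< (card q B) _ _ (begin-strict
          card q B + card q B           ≡⟨ double (card q B) ⟨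
          2 * card q B                  ≡⟨ cong (2 *_) (split x) ⟨
          2 * (misses x + hits x)       ≡⟨ *-distribˡ-+ 2 (misses x) (hits x) ⟩
          2 * misses x + 2 * hits x     <⟨ +-monoˡ-< (2 * hits x) few ⟩
          card q B + 2 * hits x         ∎)
    where
    open ≤-Reasoning
    hits misses : ℕ → ℕ
    hits   x = card q λ z → B z ∧ S (z + x)
    misses x = card q λ z → B z ∧ not (S (z + x))
    double : ∀ n → 2 * n ≡ n + n
    double = solve-∀
    cancel : ∀ b {m n} → ⟦ b ⟧ * m < ⟦ b ⟧ * n → T b × m < n
    cancel true {m} {n} lt = tt , subst₂ _<_ (+-identityʳ m) (+-identityʳ n) lt
    split : ∀ x → misses x + hits x ≡ card q B
    split x = trans (sym (∑-+ q _ _)) (∑-cong q λ z → split′ (B z) (S (z + x)))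
      where
      split′ : ∀ b c → ⟦ b ∧ not c ⟧ + ⟦ b ∧ c ⟧ ≡ ⟦ b ⟧
      split′ false _     = refl
      split′ true  false = refl
      split′ true  true  = refl
    exchange : ∀ b c d → ⟦ b ⟧ * ⟦ c ∧ d ⟧ ≡ ⟦ c ⟧ * ⟦ b ∧ d ⟧
    exchange false false d = refl
    exchange false true  d = refl
    exchange true  false d = refl
    exchange true  true  d = refl
    move-2 : ∀ a b → a * (2 * b) ≡ 2 * (a * b)
    move-2 = solve-∀
    average : ∑ q (λ x → ⟦ S x ⟧ * (2 * misses x)) < ∑ q (λ x → ⟦ S x ⟧ * card q B)
    average = begin-strict
      ∑ q (λ x → ⟦ S x ⟧ * (2 * misses x))
        ≡⟨ ∑-cong q (λ x → move-2 ⟦ S x ⟧ (misses x)) ⟩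
      ∑ q (λ x → 2 * (⟦ S x ⟧ * misses x))
        ≡⟨ ∑-* q 2 _ ⟩
      2 * ∑ q (λ x → ⟦ S x ⟧ * misses x)
        ≡⟨ cong (2 *_) (∑-cong q λ x → sym (∑-* q ⟦ S x ⟧ _)) ⟩
      2 * ∑ q (λ x → ∑ q (λ z → ⟦ S x ⟧ * ⟦ B z ∧ not (S (z + x)) ⟧))
        ≡⟨ cong (2 *_) (∑-swap q q _) ⟩
      2 * ∑ q (λ z → ∑ q (λ x → ⟦ S x ⟧ * ⟦ B z ∧ not (S (z + x)) ⟧))
        ≡⟨ cong (2 *_) (∑-cong q λ z → ∑-cong q λ x → exchange (S x) (B z) (not (S (z + x)))) ⟩
      2 * ∑ q (λ z → ∑ q (λ x → ⟦ B z ⟧ * ⟦ S x ∧ not (S (z + x)) ⟧))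
        ≡⟨ cong (2 *_) (∑-cong q λ z → ∑-* q ⟦ B z ⟧ _) ⟩
      2 * ∑ q (λ z → ⟦ B z ⟧ * loss z)
        ≤⟨ *-monoʳ-≤ 2 (∑-mono q λ z _ → bounded (B z) (B-loss z)) ⟩
      2 * ∑ q (λ z → η * ⟦ B z ⟧)
        ≡⟨ cong (2 *_) (∑-* q η _) ⟩
      2 * (η * card q B)
        ≡⟨ *-assoc 2 η (card q B) ⟨
      2 * η * card q B
        <⟨ *-monoˡ-< (card q B) {{>-nonZero 0<B}} 2η<size ⟩
      size * card q B
        ≡⟨ *-comm size (card q B) ⟩
      card q B * size
        ≡⟨ ∑-* q (card q B) _ ⟨
      ∑ q (λ x → card q B * ⟦ S x ⟧)
        ≡⟨ ∑-cong q (λ x → *-comm (card q B) ⟦ S x ⟧) ⟩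
      ∑ q (λ x → ⟦ S x ⟧ * card q B) ∎
      where
      bounded : ∀ b {l} → (T b → l ≤ η) → ⟦ b ⟧ * l ≤ η * ⟦ b ⟧
      bounded false _  = z≤n
      bounded true {l} l≤η = subst₂ _≤_ (sym (+-identityʳ l)) (sym (*-identityʳ η)) (l≤η tt)

  level : ℕ → ℕ → Bool
  level η z = loss z ≤ᵇ η

  level-periodic : ∀ η → Periodic q (level η)
  level-periodic η z = cong (_≤ᵇ η) (loss-periodic z)

  0<card-level : ∀ η → 0 < card q (level η)
  0<card-level η = ≤-trans (T⇒1≤⟦⟧ (≤⇒≤ᵇ (subst (_≤ η) (sym loss-zero) z≤n)))
    (term≤∑ q (λ z → ⟦ level η z ⟧) (>-nonZero⁻¹ q))

  -- `W` holds offsets: the residues of small loss are the `h + x`, since the values of the block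
  -- will start at `h`.
  module _ (h : ℕ) (W : ℕ → Bool) (δ : ℕ) (W-loss : ∀ x → x < q → T (W x) → loss (h + x) ≤ δ) where

    -- The translate z + h + W lies in the level η + 3δ but avoids the level η.
    level-growth : ∀ η z → η + δ < loss z → loss z ≤ η + 2 * δ →
                   card q (level η) + card q W ≤ card q (level (η + 3 * δ))
    level-growth η z η+δ<loss loss≤η+2δ = begin
      card q (level η) + card q W
        ≡⟨ cong (_+ card q W) (∑-shift (λ y → cong ⟦_⟧ (level-periodic η y)) (z + h)) ⟨
      ∑ q (λ x → ⟦ level η (z + h + x) ⟧) + card q W
        ≡⟨ ∑-+ q _ _ ⟨
      ∑ q (λ x → ⟦ level η (z + h + x) ⟧ + ⟦ W x ⟧)
        ≤⟨ ∑-mono q pointwise ⟩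
      ∑ q (λ x → ⟦ level (η + 3 * δ) (z + h + x) ⟧)
        ≡⟨ ∑-shift (λ y → cong ⟦_⟧ (level-periodic (η + 3 * δ) y)) (z + h) ⟩
      card q (level (η + 3 * δ)) ∎
      where
      open ≤-Reasoning
      disjoint : ∀ {b c d} → (T b → T d) → (T c → T d) → (T c → ¬ T b) → ⟦ b ⟧ + ⟦ c ⟧ ≤ ⟦ d ⟧
      disjoint {b}    {false}     b⇒d c⇒d c⇒¬b = ≤-trans (≤-reflexive (+-identityʳ ⟦ b ⟧)) (⟦⟧-mono b⇒d)
      disjoint {false} {true}     b⇒d c⇒d c⇒¬b = ⟦⟧-mono c⇒d
      disjoint {true}  {true}     b⇒d c⇒d c⇒¬b = ⊥-elim (c⇒¬b tt tt)
      regroup : ∀ η δ → η + 2 * δ + δ ≡ η + 3 * δ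
      regroup = solve-∀
      pointwise : ∀ x → x < q →
        ⟦ level η (z + h + x) ⟧ + ⟦ W x ⟧ ≤ ⟦ level (η + 3 * δ) (z + h + x) ⟧
      pointwise x x<q = disjoint
        (λ l → ≤⇒≤ᵇ (≤-trans (≤ᵇ⇒≤ (loss (z + h + x)) η l) (m≤m+n η (3 * δ))))
        (λ w → ≤⇒≤ᵇ (begin
          loss (z + h + x)            ≡⟨ cong loss (+-assoc z h x) ⟩
          loss (z + (h + x))          ≤⟨ loss-+ z (h + x) ⟩
          loss z + loss (h + x)       ≤⟨ +-mono-≤ loss≤η+2δ (W-loss x x<q w) ⟩
          η + 2 * δ + δ               ≡⟨ regroup η δ ⟩
          η + 3 * δ                   ∎))
        (λ w l → <⇒≱ η+δ<loss (begin
          loss z                              ≤⟨ loss-+ʳ z (h + x) ⟩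
          loss (z + (h + x)) + loss (h + x)   ≡⟨ cong (λ y → loss y + loss (h + x)) (+-assoc z h x) ⟨
          loss (z + h + x) + loss (h + x)     ≤⟨ +-mono-≤ (≤ᵇ⇒≤ _ _ l) (W-loss x x<q w) ⟩
          η + δ                               ∎))

    -- The window `(η + δ, η + 2δ]` contains no loss. A translation of loss at most `δ` cannot jump
    -- over it, so the level `η + δ` is stable under such translations.
    Gap : ℕ → Set
    Gap η = ∀ z → loss z ≤ η + 2 * δ → loss z ≤ η + δ

    gap-or-growth : ∀ η → Gap η ⊎ (card q (level η) + card q W ≤ card q (level (η + 3 * δ)))
    -- Losses are periodic, so searching one period settles all `z`.
    gap-or-growth η with anyUpTo? (λ z → (η + δ <? loss z) ×-dec (loss z ≤? η + 2 * δ)) q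
    ... | yes (z , _ , η+δ<loss , loss≤η+2δ) = inj₂ (level-growth η z η+δ<loss loss≤η+2δ)
    ... | no none = inj₁ λ z loss≤ → ≮⇒≥ λ <loss →
      none (z % q , m%n<n z q , subst (η + δ <_) (sym (periodic-% loss-periodic z)) <loss
                              , subst (_≤ η + 2 * δ) (sym (periodic-% loss-periodic z)) loss≤)

    -- Every missing gap adds `card q W` elements to the level, at the price of raising the
    -- threshold by `3 * δ`.
    find-gap : ∀ i → (i * card q W ≤ card q (level (i * (3 * δ)))) ⊎ (∃ λ j → j < i × Gap (j * (3 * δ)))
    find-gap zero = inj₁ z≤n
    find-gap (suc i) with find-gap i
    ... | inj₂ (j , j<i , gap) = inj₂ (j , m<n⇒m<1+n j<i , gap)
    ... | inj₁ large with gap-or-growth (i * (3 * δ))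
    ...   | inj₁ gap  = inj₂ (i , ≤-refl , gap)
    ...   | inj₂ grow = inj₁ (begin
      card q W + i * card q W                       ≡⟨ +-comm (card q W) _ ⟩
      i * card q W + card q W                       ≤⟨ +-monoˡ-≤ (card q W) large ⟩
      card q (level (i * (3 * δ))) + card q W       ≤⟨ grow ⟩
      card q (level (i * (3 * δ) + 3 * δ))          ≡⟨ cong (λ e → card q (level e)) (+-comm (i * (3 * δ)) (3 * δ)) ⟩
      card q (level (suc i * (3 * δ)))              ∎)
      where open ≤-Reasoning

    gap-closed : ∀ η → Gap η → ∀ x → x < q → T (W x) →
                 ∀ z → T (level (η + δ) z) → T (level (η + δ) (h + x + z))
    gap-closed η gap x x<q w z l = ≤⇒≤ᵇ (gap (h + x + z) (begin
      loss (h + x + z)        ≤⟨ loss-+ (h + x) z ⟩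
      loss (h + x) + loss z   ≤⟨ +-mono-≤ (W-loss x x<q w) (≤ᵇ⇒≤ _ _ l) ⟩
      δ + (η + δ)             ≡⟨ regroup η δ ⟩
      η + 2 * δ               ∎))
      where
      open ≤-Reasoning
      regroup : ∀ η δ → δ + (η + δ) ≡ η + 2 * δ
      regroup = solve-∀

    -- If the first `I` thresholds had no gap, the level reached would have at least `2 * size`
    -- elements. Its losses are still below `size / 2`, so by `majority` more than half of it lies
    -- in a translate of `S`, which forces fewer than `2 * size` elements.
    gap-with-majority : 20 * δ < card q W → card q W ≤ size →
      ∃ λ η → Gap η × ∃ λ x → x < q × T (S x) ×
        card q (level (η + δ)) < 2 * card q (λ z → level (η + δ) z ∧ S (z + x))
    gap-with-majority 20δ<W W≤size = conclude (find-gap I)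
      where
      open ≤-Reasoning
      instance
        W≢0 : NonZero (card q W)
        W≢0 = >-nonZero (≤-<-trans z≤n 20δ<W)
      w = card q W
      -- Rounding up gives `2 * size ≤ I * w`, and `w ≤ size` keeps `I * w ≤ 3 * size`.
      I = suc (2 * size / w)
      0<size : 0 < size
      0<size = <-≤-trans (>-nonZero⁻¹ w) W≤size
      Iw≤3size : I * w ≤ 3 * size
      Iw≤3size = +-mono-≤ W≤size (m/n*n≤m (2 * size) w)
      2size≤Iw : 2 * size ≤ I * w
      2size≤Iw = begin
        2 * size                                       ≡⟨ m≡m%n+[m/n]*n (2 * size) w ⟩
        2 * size % w + 2 * size / w * w                ≤⟨ +-monoˡ-≤ _ (<⇒≤ (m%n<n (2 * size) w)) ⟩
        I * w                                          ∎
      -- Here the constant 20 is decided: `6 * I * δ` is at most `6 * 3 * size / 20`, and `18 < 20`.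
      small : 2 * (I * (3 * δ)) < size
      small = *-cancelˡ-< 20 _ _ (begin-strict
        20 * (2 * (I * (3 * δ)))    ≡⟨ regroup I δ ⟩
        6 * (I * (20 * δ))          ≤⟨ *-monoʳ-≤ 6 (*-monoʳ-≤ I (<⇒≤ 20δ<W)) ⟩
        6 * (I * w)                 ≤⟨ *-monoʳ-≤ 6 Iw≤3size ⟩
        6 * (3 * size)              ≡⟨ *-assoc 6 3 size ⟨
        18 * size                   <⟨ *-monoˡ-< size {{>-nonZero 0<size}} {18} {20} (s≤s (n≤1+n 18)) ⟩
        20 * size                   ∎)
        where
        regroup : ∀ i d → 20 * (2 * (i * (3 * d))) ≡ 6 * (i * (20 * d))
        regroup = solve-∀
      conclude : (I * w ≤ card q (level (I * (3 * δ)))) ⊎ (∃ λ j → j < I × Gap (j * (3 * δ))) →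
        ∃ λ η → Gap η × ∃ λ x → x < q × T (S x) ×
          card q (level (η + δ)) < 2 * card q (λ z → level (η + δ) z ∧ S (z + x))
      conclude (inj₂ (j , j<I , gap)) = j * (3 * δ) , gap ,
        majority (j * (3 * δ) + δ) (level (j * (3 * δ) + δ)) (λ z → ≤ᵇ⇒≤ (loss z) _) (0<card-level _)
          (≤-<-trans (*-monoʳ-≤ 2 below) small)
        where
        below : j * (3 * δ) + δ ≤ I * (3 * δ)
        below = begin
          j * (3 * δ) + δ        ≤⟨ +-monoʳ-≤ (j * (3 * δ)) (m≤m+n δ (2 * δ)) ⟩
          j * (3 * δ) + 3 * δ    ≡⟨ +-comm (j * (3 * δ)) (3 * δ) ⟩
          suc j * (3 * δ)        ≤⟨ *-monoˡ-≤ (3 * δ) j<I ⟩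
          I * (3 * δ)            ∎
      conclude (inj₁ large) =
        let x , _ , _ , many = majority η (level η) (λ z → ≤ᵇ⇒≤ (loss z) η) (0<card-level η) small
        in  contradiction (begin-strict
              2 * size                                        ≤⟨ 2size≤Iw ⟩
              I * w                                           ≤⟨ large ⟩
              card q (level η)                                <⟨ many ⟩
              2 * card q (λ z → level η z ∧ S (z + x))        ≤⟨ *-monoʳ-≤ 2 (∑-mono q λ z _ → ⟦⟧-mono λ t → subst T (cong S (+-comm z x)) (proj₂ (T-∧⁻ {level η z} t))) ⟩
              2 * ∑ q (λ z → ⟦ S (x + z) ⟧)                   ≡⟨ cong (2 *_) (∑-shift (λ y → cong ⟦_⟧ (S-per y)) x) ⟩
              2 * size                                        ∎)
            (<-irrefl refl)
        where
        η = I * (3 * δ)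

  -- For every translation g preserving B, the reflection z ↦ g − z maps B to itself, so a subset
  -- with more than half of the elements of B meets its mirror image.
  module _ (B : ℕ → Bool) (B-per : Periodic q B) (B-neg : ∀ z → T (B z) → T (B (neg z)))
           (x : ℕ) (half : card q B < 2 * card q (λ z → B z ∧ S (z + x))) where

    private module 𝑩 = Loss q B B-per

    doubles : ∀ g → 𝑩.loss g ≡ 0 →
              ∃ λ s → ∃ λ s′ → T (S s) × T (S s′) × s + s′ ≡ q + (x + x + g)
    doubles g stab =
      let z , z<q , lt = ∑-<⇒∃ q {λ z → ⟦ B z ⟧} {λ z → ⟦ P z ⟧ + ⟦ P (mirror z) ⟧} pairs
          Pz , Pz′ = both (λ Pz → proj₁ (T-∧⁻ Pz)) (λ Pz′ → unmirror z z<q (proj₁ (T-∧⁻ Pz′))) lt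
      in  z + x , mirror z + x , proj₂ (T-∧⁻ {B z} Pz) , proj₂ (T-∧⁻ {B (mirror z)} Pz′) ,
          trans (regroup z (mirror z) x) (trans (cong (_+ (x + x)) (+-mirror z z<q)) (regroup′ g q x))
      where
      open ≤-Reasoning
      P : ℕ → Bool
      P z = B z ∧ S (z + x)
      P-per : Periodic q P
      P-per z = cong₂ _∧_ (B-per z) (trans (cong S (+-assoc q z x)) (S-per (z + x)))
      mirror : ℕ → ℕ
      mirror z = g + (q ∸ z)
      regroup : ∀ a b c → a + c + (b + c) ≡ a + b + (c + c)
      regroup = solve-∀
      regroup′ : ∀ a b c → a + b + (c + c) ≡ b + (c + c + a)
      regroup′ = solve-∀
      reverse₃ : ∀ a b c → a + (b + c) ≡ c + (b + a)
      reverse₃ = solve-∀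
      +-mirror : ∀ z → z < q → z + mirror z ≡ g + q
      +-mirror z z<q = trans (x∙yz≈y∙xz z g (q ∸ z)) (cong (g +_) (m+[n∸m]≡n (<⇒≤ z<q)))
      -- Modulo `q`, `z` is `g − mirror z`, so it lies in `B` by the symmetry of `B` and its
      -- stability under `g`.
      unmirror : ∀ z → z < q → T (B (mirror z)) → T (B z)
      unmirror z z<q Bz′ = subst T same (𝑩.loss≡0⇒closed g stab (neg (mirror z)) (B-neg (mirror z) Bz′))
        where
        same : B (g + neg (mirror z)) ≡ B z
        same = trans (sym (B-per _)) (trans (cong B (trans (reverse₃ q g _)
          (trans (cong (neg (mirror z) +_) (sym (+-mirror z z<q)))
          (trans (reverse₃ (neg (mirror z)) z (mirror z)) (trans (x∙yz≈y∙xz (mirror z) z (neg (mirror z)))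
          (trans (cong (z +_) (+-neg (mirror z))) (+-comm z _)))))))
          (periodic-* B-per (mirror z) z))
      both : ∀ {a b c} → (T a → T c) → (T b → T c) → ⟦ c ⟧ < ⟦ a ⟧ + ⟦ b ⟧ → T a × T b
      both {true}  {true}          _   _   _  = tt , tt
      both {true}  {false} {true}  _   _   lt = contradiction lt (<-irrefl refl)
      both {true}  {false} {false} a⇒c _   lt = ⊥-elim (a⇒c tt)
      both {false} {true}  {true}  _   _   lt = contradiction lt (<-irrefl refl)
      both {false} {true}  {false} _   b⇒c lt = ⊥-elim (b⇒c tt)
      pairs : card q B < ∑ q (λ z → ⟦ P z ⟧ + ⟦ P (mirror z) ⟧)
      pairs = begin-strict
        card q B                                          <⟨ half ⟩
        card q P + (card q P + 0)                         ≡⟨ cong (card q P +_) (+-identityʳ (card q P)) ⟩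
        card q P + card q P                               ≡⟨ cong (card q P +_) (∑-reflect (λ y → cong ⟦_⟧ (P-per y)) g) ⟨
        card q P + ∑ q (λ z → ⟦ P (mirror z) ⟧)           ≡⟨ ∑-+ q _ _ ⟨
        ∑ q (λ z → ⟦ P z ⟧ + ⟦ P (mirror z) ⟧)            ∎

-- Small elements of the stabiliser

module _ (q : ℕ) .{{_ : NonZero q}} (B : ℕ → Bool) (B-per : Periodic q B) where
  open Loss q B B-per

  -- The stabiliser has at least `card q W` residues, so a window of `D` consecutive residues
  -- contains more than one of them on average. The difference of two in the same window is below
  -- `D` and stabilises `B` as well.
  small-stabiliser : ∀ (h : ℕ) (W : ℕ → Bool) → (∀ x → x < q → T (W x) → loss (h + x) ≡ 0) →
                     ∀ D → q < D * card q W → ∃ λ d → 0 < d × d < D × loss d ≡ 0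
  small-stabiliser h W W-stab D q<DW =
    let x , _ , 1<f = ∑-<⇒∃ q {λ _ → 1} {λ x → ∑ D (λ e → ⟦ stab (e + x) ⟧)} total
        e , e′ , e<e′ , e′<D , f , f′ = two-terms D (λ e → ⟦ stab (e + x) ⟧) (λ e → ⟦⟧≤1 (stab (e + x))) 1<f
        stab⇒ = λ y (t : 0 < ⟦ stab y ⟧) → n≤0⇒n≡0 (≤ᵇ⇒≤ (loss y) 0 (0<⟦⟧⇒T t))
    in  e′ ∸ e , m<n⇒0<n∸m e<e′ , ≤-<-trans (m∸n≤m e′ e) e′<D ,
        n≤0⇒n≡0 (begin
          loss (e′ ∸ e)                                  ≤⟨ loss-+ʳ (e′ ∸ e) (e + x) ⟩
          loss (e′ ∸ e + (e + x)) + loss (e + x)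
            ≡⟨ cong₂ (λ y l → loss y + l) (trans (sym (+-assoc (e′ ∸ e) e x)) (cong (_+ x) (m∸n+n≡m (<⇒≤ e<e′)))) (stab⇒ (e + x) f) ⟩
          loss (e′ + x) + 0                              ≡⟨ cong (_+ 0) (stab⇒ (e′ + x) f′) ⟩
          0                                              ∎)
    where
    open ≤-Reasoning
    stab : ℕ → Bool
    stab y = loss y ≤ᵇ 0
    stab-per : Periodic q (λ y → ⟦ stab y ⟧)
    stab-per y = cong (λ l → ⟦ l ≤ᵇ 0 ⟧) (loss-periodic y)
    W≤stab : card q W ≤ card q stab
    W≤stab = subst (card q W ≤_) (∑-shift stab-per h) (∑-mono q λ x x<q →
      ⟦⟧-mono λ w → ≤⇒≤ᵇ (≤-reflexive (W-stab x x<q w)))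
    total : ∑ q (λ _ → 1) < ∑ q (λ x → ∑ D (λ e → ⟦ stab (e + x) ⟧))
    total = begin-strict
      ∑ q (λ _ → 1)                                 ≡⟨ trans (∑-const q 1) (*-identityʳ q) ⟩
      q                                             <⟨ q<DW ⟩
      D * card q W                                  ≤⟨ *-monoʳ-≤ D W≤stab ⟩
      D * card q stab                               ≡⟨ ∑-const D _ ⟨
      ∑ D (λ _ → card q stab)                       ≡⟨ ∑-cong D (λ e → sym (∑-shift stab-per e)) ⟩
      ∑ D (λ e → ∑ q (λ x → ⟦ stab (e + x) ⟧))      ≡⟨ ∑-swap D q _ ⟩
      ∑ q (λ x → ∑ D (λ e → ⟦ stab (e + x) ⟧))      ∎

-- The stable level is symmetric and its stabiliser contains all `h + x` with `x` in `W`, hence a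
-- small `d`. All multiples of `d` stabilise it too, and `doubles` applies to each of them with the
-- same `x`.
slow-growth⇒progression : ∀ q .{{_ : NonZero q}} (S : ℕ → Bool) (S-per : Periodic q S)
  (h : ℕ) (W : ℕ → Bool) (δ : ℕ) → (∀ x → x < q → T (W x) → Loss.loss q S S-per (h + x) ≤ δ) →
  20 * δ < card q W → card q W ≤ card q S → ∀ D → q < D * card q W →
  ∃ λ x → x < q × ∃ λ d → 0 < d × d < D ×
    ∀ k → ∃ λ s → ∃ λ s′ → T (S s) × T (S s′) × s + s′ ≡ q + (x + x + k * d)
slow-growth⇒progression q S S-per h W δ W-loss 20δ<W W≤S D q<DW =
  let η , gap , x , x<q , _ , half = gap-with-majority h W δ W-loss 20δ<W W≤S
      B = level (η + δ)
      B-per = level-periodic (η + δ)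
      B-neg = λ z (l : T (B z)) → subst (λ y → T (y ≤ᵇ η + δ)) (sym (loss-neg z (neg z) z (+-neg z))) l
      d , 0<d , d<D , stab = small-stabiliser q B B-per h W
        (λ y y<q w → Loss.closed⇒loss≡0 q B B-per (h + y) (gap-closed h W δ W-loss η gap y y<q w)) D q<DW
  in  x , x<q , d , 0<d , d<D , λ k →
      doubles B B-per B-neg x half (k * d) (Loss.loss-* q B B-per d stab k)
  where
  open Loss q S S-per
  open Translates q S S-per

-- Sumsets of nested layers

≢⇒⟦≡ᵇ⟧≡0 : ∀ {x y} → x ≢ y → ⟦ x ≡ᵇ y ⟧ ≡ 0
≢⇒⟦≡ᵇ⟧≡0 {x} {y} x≢y = n≤0⇒n≡0 (⟦⟧-mono {x ≡ᵇ y} {false} (x≢y ∘ ≡ᵇ⇒≡ x y))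

∑-δ : ∀ n (f : ℕ → ℕ) {k} → k < n → ∑ n (λ x → ⟦ x ≡ᵇ k ⟧ * f x) ≡ f k
∑-δ (suc n) f {k} k<1+n with n ≟ k
... | yes refl = trans (cong₂ _+_ (cong (_* f n) (hit n))
        (∑-zero n λ x x<n → cong (_* f x) (≢⇒⟦≡ᵇ⟧≡0 (<⇒≢ x<n))))
        (trans (+-identityʳ _) (+-identityʳ _))
  where
  hit : ∀ n → ⟦ n ≡ᵇ n ⟧ ≡ 1
  hit zero    = refl
  hit (suc n) = hit n
... | no n≢k = trans (cong (λ b → b * f n + ∑ n (λ x → ⟦ x ≡ᵇ k ⟧ * f x)) (≢⇒⟦≡ᵇ⟧≡0 n≢k))
        (∑-δ n f (≤∧≢⇒< (s≤s⁻¹ k<1+n) (n≢k ∘ sym)))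

-- The total of a multiset that contains the value `h + x` exactly `c x` times.
weighted : ℕ → ℕ → (ℕ → ℕ) → ℕ
weighted q h c = ∑ q λ x → c x * (h + x)

weighted-+ : ∀ q h c c′ → weighted q h (λ x → c x + c′ x) ≡ weighted q h c + weighted q h c′
weighted-+ q h c c′ = trans (∑-cong q λ x → *-distribʳ-+ (h + x) (c x) (c′ x)) (∑-+ q _ _)

weighted-δ : ∀ q h j {k} → k < q → weighted q h (λ x → j * ⟦ x ≡ᵇ k ⟧) ≡ j * (h + k)
weighted-δ q h j {k} k<q = trans (∑-cong q λ x → *-assoc j ⟦ x ≡ᵇ k ⟧ (h + x))
  (trans (∑-* q j _) (cong (j *_) (∑-δ q (h +_) k<q)))

-- Layer cake inequality, used to pass from multiplicities to sizes of layers.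
m⊓t≤∑ : ∀ m t → m ⊓ t ≤ ∑ t (λ j → ⟦ j <ᵇ m ⟧)
m⊓t≤∑ m zero = ≤-reflexive (⊓-zeroʳ m)
m⊓t≤∑ m (suc t) with t <? m
... | yes t<m = begin
  m ⊓ suc t                                ≤⟨ m⊓n≤n m (suc t) ⟩
  1 + t                                    ≤⟨ +-mono-≤ (T⇒1≤⟦⟧ (<⇒<ᵇ t<m)) (≤-trans (≤-reflexive (sym (m≥n⇒m⊓n≡n (<⇒≤ t<m)))) (m⊓t≤∑ m t)) ⟩
  ∑ (suc t) (λ j → ⟦ j <ᵇ m ⟧)             ∎
  where open ≤-Reasoning
... | no t≮m = begin
  m ⊓ suc t                                ≤⟨ m⊓n≤m m (suc t) ⟩
  m                                        ≡⟨ m≤n⇒m⊓n≡m (≮⇒≥ t≮m) ⟨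
  m ⊓ t                                    ≤⟨ m⊓t≤∑ m t ⟩
  ∑ t (λ j → ⟦ j <ᵇ m ⟧)                   ≤⟨ m≤n+m _ _ ⟩
  ∑ (suc t) (λ j → ⟦ j <ᵇ m ⟧)             ∎
  where open ≤-Reasoning

%-cong-+ : ∀ q .{{_ : NonZero q}} {a b c d} → a % q ≡ b % q → c % q ≡ d % q → (a + c) % q ≡ (b + d) % q
%-cong-+ q {a} {b} {c} {d} a≡b c≡d = trans (%-distribˡ-+ a c q)
  (trans (cong₂ (λ x y → (x + y) % q) a≡b c≡d) (sym (%-distribˡ-+ b d q)))

≡-%⇒+* : ∀ q .{{_ : NonZero q}} {m n} → m ≤ n → m % q ≡ n % q → ∃ λ j → n ≡ m + j * q
≡-%⇒+* q {m} {n} m≤n m≡n = n / q ∸ m / q , (begin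
  n                                              ≡⟨ m≡m%n+[m/n]*n n q ⟩
  n % q + n / q * q                              ≡⟨ cong₂ (λ r k → r + k * q) m≡n (m+[n∸m]≡n (/-monoˡ-≤ q m≤n)) ⟨
  m % q + (m / q + (n / q ∸ m / q)) * q          ≡⟨ distrib (m % q) (m / q) _ q ⟩
  m % q + m / q * q + (n / q ∸ m / q) * q        ≡⟨ cong (_+ (n / q ∸ m / q) * q) (m≡m%n+[m/n]*n m q) ⟨
  m + (n / q ∸ m / q) * q                        ∎)
  where
  open ≡-Reasoning
  distrib : ∀ r k l q → r + (k + l) * q ≡ r + k * q + l * q
  distrib = solve-∀

-- The value `h + x` belongs to `m x` layers. The modulus is itself the value that lies in most
-- layers, so its copies are neutral modulo `q` and plentiful.
module Layers (q : ℕ) .{{_ : NonZero q}} (h : ℕ) (h≤q : h ≤ q) (m : ℕ → ℕ)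
              (x₀ : ℕ) (x₀<q : x₀ < q) (h+x₀≡q : h + x₀ ≡ q) (m≤mx₀ : ∀ x → x < q → m x ≤ m x₀) where

  t : ℕ
  t = m x₀

  W : ℕ → ℕ → Bool
  W j x = j <ᵇ m x

  -- pred q * w represents −w modulo q.
  S : ℕ → ℕ → Bool
  S zero    y = y % q ≡ᵇ 0
  S (suc i) y = 0 <ᵇ ∑ q (λ x → ⟦ W i x ∧ S i (pred q * (h + x) + y) ⟧)

  S-per : ∀ i → Periodic q (S i)
  S-per zero    y = cong (_≡ᵇ 0) (trans (cong (_% q) (+-comm q y)) ([m+n]%n≡m%n y q))
  S-per (suc i) y = cong (0 <ᵇ_) (∑-cong q λ x → cong (λ b → ⟦ W i x ∧ b ⟧)
    (trans (cong (S i) (x∙yz≈y∙xz (pred q * (h + x)) q y)) (S-per i (pred q * (h + x) + y))))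

  +-pred-* : ∀ w y → pred q * w + (w + y) ≡ w * q + y
  +-pred-* w y = trans (regroup (pred q) w y) (cong (λ q → w * q + y) (suc-pred q))
    where
    regroup : ∀ p w y → p * w + (w + y) ≡ w * suc p + y
    regroup = solve-∀

  S-+ : ∀ i x y → x < q → T (W i x) → T (S i y) → T (S (suc i) (h + x + y))
  S-+ i x y x<q w s = <⇒<ᵇ (≤-trans
    (T⇒1≤⟦⟧ (T-∧⁺ {W i x} w (subst T (sym (trans (cong (S i) (+-pred-* (h + x) y)) (periodic-* (S-per i) (h + x) y))) s)))
    (term≤∑ q (λ x′ → ⟦ W i x′ ∧ S i (pred q * (h + x′) + (h + x + y)) ⟧) x<q))

  -- The offset `x₀` lies in every layer below `t`, and its value `q` is zero modulo `q`.
  S-suc : ∀ i → i < t → ∀ y → T (S i y) → T (S (suc i) y)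
  S-suc i i<t y s = subst T (trans (cong (λ w → S (suc i) (w + y)) h+x₀≡q) (S-per (suc i) y))
    (S-+ i x₀ y x₀<q (<⇒<ᵇ i<t) s)

  -- `S (suc i)` contains both `S i` and its translate by `h + x`, and `loss (h + x)` counts the
  -- elements of the translate that are outside `S i`.
  S-growth : ∀ i → i < t → ∀ x → x < q → T (W i x) →
             Loss.loss q (S i) (S-per i) (h + x) + card q (S i) ≤ card q (S (suc i))
  S-growth i i<t x x<q w = begin
    loss (h + x) + card q (S i)
      ≡⟨ cong (loss (h + x) +_) (∑-shift (λ y → cong ⟦_⟧ (S-per i y)) (h + x)) ⟨
    loss (h + x) + ∑ q (λ y → ⟦ S i (h + x + y) ⟧)
      ≡⟨ ∑-+ q _ _ ⟨
    ∑ q (λ y → ⟦ S i y ∧ not (S i (h + x + y)) ⟧ + ⟦ S i (h + x + y) ⟧)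
      ≤⟨ ∑-mono q (λ y _ → union (S-+ i x y x<q w) (S-suc i i<t (h + x + y))) ⟩
    ∑ q (λ y → ⟦ S (suc i) (h + x + y) ⟧)
      ≡⟨ ∑-shift (λ y → cong ⟦_⟧ (S-per (suc i) y)) (h + x) ⟩
    card q (S (suc i)) ∎
    where
    open ≤-Reasoning
    open Loss q (S i) (S-per i)
    union : ∀ {b c d} → (T b → T d) → (T c → T d) → ⟦ b ∧ not c ⟧ + ⟦ c ⟧ ≤ ⟦ d ⟧
    union {false} {c}     b⇒d c⇒d = ⟦⟧-mono c⇒d
    union {true}  {false} b⇒d c⇒d = ⟦⟧-mono b⇒d
    union {true}  {true}  b⇒d c⇒d = ⟦⟧-mono c⇒d

  value : (ℕ → ℕ) → ℕ
  value = weighted q h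

  -- One value is chosen from each of the first `i` layers. The choice respects the multiplicities
  -- since `h + x` occurs only in the layers below `m x`. The size of the total is recorded because
  -- the residue will be lifted to an integer.
  realise : ∀ i y → T (S i y) → ∃ λ c →
            (∀ x → c x ≤ i ⊓ m x) × value c ≤ i * (2 * q) × value c % q ≡ y % q
  realise zero y y≡0 = (λ _ → 0) , (λ _ → z≤n) , ≤-reflexive value≡0 ,
    trans (cong (_% q) value≡0) (trans (m*n%n≡0 0 q) (sym (≡ᵇ⇒≡ (y % q) 0 y≡0)))
    where
    value≡0 : value (λ _ → 0) ≡ 0
    value≡0 = ∑-zero q λ _ _ → refl
  realise (suc i) y Sy
    with x , x<q , hit ← ∑-positive q {λ x → ⟦ W i x ∧ S i (pred q * (h + x) + y) ⟧} (<ᵇ⇒< 0 _ Sy)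
    with w , Si ← T-∧⁻ {W i x} (0<⟦⟧⇒T hit)
    with c , c≤ , value≤ , value≡ ← realise i (pred q * (h + x) + y) Si
    = (λ x′ → 1 * ⟦ x′ ≡ᵇ x ⟧ + c x′) , bound , ≤-trans (≤-reflexive total) (+-mono-≤ h+x≤2q value≤) ,
      trans (cong (_% q) total) (trans (%-cong-+ q {h + x} refl value≡)
        (trans (cong (_% q) (trans (x∙yz≈y∙xz (h + x) (pred q * (h + x)) y) (trans (+-pred-* (h + x) y) (+-comm _ y)))) ([m+kn]%n≡m%n y (h + x) q)))
    where
    total : value (λ x′ → 1 * ⟦ x′ ≡ᵇ x ⟧ + c x′) ≡ h + x + value c
    total = trans (weighted-+ q h (λ x′ → 1 * ⟦ x′ ≡ᵇ x ⟧) c) (cong (_+ value c) (trans (weighted-δ q h 1 x<q) (+-identityʳ (h + x))))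
    h+x≤2q : h + x ≤ 2 * q
    h+x≤2q = +-mono-≤ h≤q (≤-trans (<⇒≤ x<q) (m≤m+n q 0))
    bound : ∀ x′ → 1 * ⟦ x′ ≡ᵇ x ⟧ + c x′ ≤ suc i ⊓ m x′
    bound x′ with x′ ≡ᵇ x in eq
    ... | false = ≤-trans (c≤ x′) (⊓-monoˡ-≤ (m x′) (n≤1+n i))
    -- Membership in layer `i` means `i < m x`, so the at most `i` copies used so far leave room for
    -- one more.
    ... | true with refl ← ≡ᵇ⇒≡ x′ x (subst T (sym eq) tt) =
      ⊓-glb (s≤s (m≤n⊓o⇒m≤n i (m x) (c≤ x))) (≤-trans (s≤s (m≤n⊓o⇒m≤n i (m x) (c≤ x))) (<ᵇ⇒< i (m x) w))

  -- The bound `d ≤ t` limits how many copies of `q` are needed to lift the residues; `d ≤ q` is for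
  -- the absorption of later terms.
  Found : Set
  Found = ∃ λ i → i ≤ t × ∃ λ x → x < q × ∃ λ d → 0 < d × d < suc (t ⊓ q) ×
    ∀ k → ∃ λ s → ∃ λ s′ → T (S i s) × T (S i s′) × s + s′ ≡ q + (x + x + k * d)

  -- Each layer is charged: a thin one, with `t * card q (W j) ≤ q`, costs `q`, and a step of fast
  -- growth costs at most twenty times the growth of the sumset. Any other step gives `Found`. The
  -- first component is carried along because a slow step requires a layer no larger than the
  -- current sumset.
  progress : ∀ i → i < t → Found ⊎
    (card q (W 0) ≤ card q (S (suc i)) ×
     t * ∑ (suc i) (λ j → card q (W j)) ≤ 20 * (t * card q (S (suc i))) + i * q)
  progress zero _ = inj₂ (W0≤S1 , (begin
    t * (card q (W 0) + 0)              ≡⟨ cong (t *_) (+-identityʳ _) ⟩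
    t * card q (W 0)                    ≤⟨ *-monoʳ-≤ t W0≤S1 ⟩
    t * card q (S 1)                    ≤⟨ m≤n*m (t * card q (S 1)) 20 ⟩
    20 * (t * card q (S 1))             ≡⟨ +-identityʳ _ ⟨
    20 * (t * card q (S 1)) + 0         ∎))
    where
    open ≤-Reasoning
    W0≤S1 : card q (W 0) ≤ card q (S 1)
    W0≤S1 = begin
      card q (W 0)                   ≤⟨ ∑-mono q (λ x x<q → ⟦⟧-mono λ w → subst (T ∘ S 1) (+-identityʳ (h + x))
                                          (S-+ 0 x 0 x<q w (≡⇒≡ᵇ (0 % q) 0 (m*n%n≡0 0 q)))) ⟩
      ∑ q (λ x → ⟦ S 1 (h + x) ⟧)    ≡⟨ ∑-shift (λ y → cong ⟦_⟧ (S-per 1 y)) h ⟩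
      card q (S 1)                   ∎
  progress (suc i) 1+i<t with progress i (<-trans (n<1+n i) 1+i<t)
  ... | inj₁ found = inj₁ found
  ... | inj₂ (W0≤S , sum≤) = step
    where
    open ≤-Reasoning
    w w′ δ : ℕ
    w  = card q (W (suc i))
    w′ = card q (S (suc i))
    δ  = card q (S (suc (suc i))) ∸ w′
    S≤S : w′ ≤ card q (S (suc (suc i)))
    S≤S = ∑-mono q λ y _ → ⟦⟧-mono (S-suc (suc i) 1+i<t y)
    w≤w′ : w ≤ w′
    w≤w′ = ≤-trans (∑-mono q λ x _ → ⟦⟧-mono λ l → <⇒<ᵇ (≤-<-trans z≤n (<ᵇ⇒< (suc i) (m x) l))) W0≤S
    W-loss : ∀ x → x < q → T (W (suc i) x) → Loss.loss q (S (suc i)) (S-per (suc i)) (h + x) ≤ δ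
    W-loss x x<q l = m+n≤o⇒m≤o∸n _ (S-growth (suc i) 1+i<t x x<q l)
    step : Found ⊎ (card q (W 0) ≤ card q (S (suc (suc i))) ×
      t * ∑ (suc (suc i)) (λ j → card q (W j)) ≤ 20 * (t * card q (S (suc (suc i)))) + (q + i * q))
    step with t * w ≤? q | w ≤? 20 * δ
    ... | yes tw≤q | _ = inj₂ (≤-trans W0≤S S≤S , (begin
      t * (w + ∑ (suc i) (λ j → card q (W j)))          ≡⟨ *-distribˡ-+ t w _ ⟩
      t * w + t * ∑ (suc i) (λ j → card q (W j))        ≤⟨ +-mono-≤ tw≤q sum≤ ⟩
      q + (20 * (t * w′) + i * q)                       ≡⟨ x∙yz≈y∙xz q (20 * (t * w′)) (i * q) ⟩
      20 * (t * w′) + (q + i * q)                       ≤⟨ +-monoˡ-≤ (q + i * q) (*-monoʳ-≤ 20 (*-monoʳ-≤ t S≤S)) ⟩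
      20 * (t * card q (S (suc (suc i)))) + (q + i * q) ∎))
    ... | no _ | yes w≤20δ = inj₂ (≤-trans W0≤S S≤S , (begin
      t * (w + ∑ (suc i) (λ j → card q (W j)))          ≡⟨ *-distribˡ-+ t w _ ⟩
      t * w + t * ∑ (suc i) (λ j → card q (W j))        ≤⟨ +-mono-≤ (*-monoʳ-≤ t w≤20δ) sum≤ ⟩
      t * (20 * δ) + (20 * (t * w′) + i * q)            ≡⟨ regroup t δ w′ (i * q) ⟩
      20 * (t * (w′ + δ)) + i * q                       ≡⟨ cong (λ s → 20 * (t * s) + i * q) (m+[n∸m]≡n S≤S) ⟩
      20 * (t * card q (S (suc (suc i)))) + i * q       ≤⟨ +-monoʳ-≤ (20 * (t * card q (S (suc (suc i))))) (m≤n+m (i * q) q) ⟩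
      20 * (t * card q (S (suc (suc i)))) + (q + i * q) ∎))
      where
      regroup : ∀ t d w r → t * (20 * d) + (20 * (t * w) + r) ≡ 20 * (t * (w + d)) + r
      regroup = solve-∀
    ... | no tw≰q | no w≰20δ = inj₁ (suc i , <⇒≤ 1+i<t ,
      slow-growth⇒progression q (S (suc i)) (S-per (suc i)) h (W (suc i)) δ W-loss (≰⇒> w≰20δ) w≤w′ (suc (t ⊓ q)) q<)
      where
      0<w : 0 < w
      0<w = ≤-<-trans z≤n (≰⇒> w≰20δ)
      -- If the minimum is `t`, the layer is not thin; if it is `q`, a nonempty layer suffices.
      q< : q < suc (t ⊓ q) * w
      q< with ⊓-sel t q
      ... | inj₁ eq rewrite eq = <-≤-trans (≰⇒> tw≰q) (m≤n+m (t * w) w)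
      ... | inj₂ eq rewrite eq = m≤m*n (suc q) w {{>-nonZero 0<w}}

  module _ (21q<m : 21 * q < ∑ q m) where

    0<t : 0 < t
    0<t = n≢0⇒n>0 λ t≡0 → <-irrefl refl (begin-strict
      21 * q          <⟨ 21q<m ⟩
      ∑ q m           ≤⟨ ∑-mono q m≤mx₀ ⟩
      ∑ q (λ _ → t)   ≡⟨ ∑-const q t ⟩
      q * t           ≡⟨ trans (cong (q *_) t≡0) (*-zeroʳ q) ⟩
      0               ≤⟨ z≤n ⟩
      21 * q          ∎)
      where open ≤-Reasoning

    -- Otherwise the charges for all `t` layers add up to at most `20 * t * q + t * q`, since no
    -- sumset exceeds `q`. This is where 21 comes from.
    found : Found
    found with progress (pred t) (≤-reflexive (suc-pred t {{>-nonZero 0<t}}))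
    ... | inj₁ f = f
    ... | inj₂ (_ , sum≤) = contradiction (begin-strict
      t * (21 * q)                                  <⟨ *-monoʳ-< t 21q<m ⟩
      t * ∑ q m                                     ≤⟨ *-monoʳ-≤ t layer-cake ⟩
      t * ∑ t (λ j → card q (W j))                  ≡⟨ cong (λ t′ → t * ∑ t′ (λ j → card q (W j))) t≡ ⟨
      t * ∑ (suc (pred t)) (λ j → card q (W j))     ≤⟨ sum≤ ⟩
      20 * (t * card q (S (suc (pred t)))) + pred t * q
        ≤⟨ +-mono-≤ (*-monoʳ-≤ 20 (*-monoʳ-≤ t card≤q)) (*-monoˡ-≤ q (pred[n]≤n {t})) ⟩
      20 * (t * q) + t * q                          ≡⟨ regroup t q ⟩
      t * (21 * q)                                  ∎) (<-irrefl refl)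
      where
      open ≤-Reasoning
      instance
        t≢0 : NonZero t
        t≢0 = >-nonZero 0<t
      t≡ : suc (pred t) ≡ t
      t≡ = suc-pred t
      regroup : ∀ t q → 20 * (t * q) + t * q ≡ t * (21 * q)
      regroup = solve-∀
      card≤q : card q (S (suc (pred t))) ≤ q
      card≤q = card≤ q (S (suc (pred t)))
      layer-cake : ∑ q m ≤ ∑ t (λ j → card q (W j))
      layer-cake = begin
        ∑ q m                                    ≤⟨ ∑-mono q (λ x x<q → ≤-trans (≤-reflexive (sym (m≤n⇒m⊓n≡m (m≤mx₀ x x<q)))) (m⊓t≤∑ (m x) t)) ⟩
        ∑ q (λ x → ∑ t (λ j → ⟦ j <ᵇ m x ⟧))     ≡⟨ ∑-swap q t (λ x j → ⟦ j <ᵇ m x ⟧) ⟩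
        ∑ t (λ j → card q (W j))                 ∎

    -- Two elements of `S i` realise the residue of each target. The shift `4 * t * q` in `b` puts
    -- every target above both realised sums together, each at most `t * (2 * q)`, so the difference
    -- is filled with copies of `q`.
    progression : ∃ λ b → ∃ λ d → 0 < d × d ≤ q ×
      ∀ k → k ≤ 8 * q → ∃ λ c → (∀ x → c x ≤ 16 * m x) × value c ≡ b + k * d
    progression with i , i≤t , x , x<q , d , 0<d , d<1+t⊓q , sums ← found = b , d , 0<d , d≤q , member
      where
      open ≤-Reasoning
      b : ℕ
      b = x + x + 4 * t * q
      d≤q : d ≤ q
      d≤q = m≤n⊓o⇒m≤o t q (s≤s⁻¹ d<1+t⊓q)
      d≤t : d ≤ t
      d≤t = m≤n⊓o⇒m≤n t q (s≤s⁻¹ d<1+t⊓q)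
      member : ∀ k → k ≤ 8 * q → ∃ λ c → (∀ x → c x ≤ 16 * m x) × value c ≡ b + k * d
      member k k≤8q
        with s , s′ , Ss , Ss′ , s+s′ ← sums k
        with c , c≤ , c-small , c≡s ← realise i s Ss
        with c′ , c′≤ , c′-small , c′≡s′ ← realise i s′ Ss′
        = conclude (≡-%⇒+* q below congruent)
        where
        below : value c + value c′ ≤ b + k * d
        below = begin
          value c + value c′             ≤⟨ +-mono-≤ c-small c′-small ⟩
          i * (2 * q) + i * (2 * q)      ≡⟨ regroup i q ⟩
          4 * i * q                      ≤⟨ *-monoˡ-≤ q (*-monoʳ-≤ 4 i≤t) ⟩
          4 * t * q                      ≤⟨ m≤n+m (4 * t * q) (x + x) ⟩
          b                              ≤⟨ m≤m+n b (k * d) ⟩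
          b + k * d                      ∎
          where
          regroup : ∀ i q → i * (2 * q) + i * (2 * q) ≡ 4 * i * q
          regroup = solve-∀
        congruent : (value c + value c′) % q ≡ (b + k * d) % q
        congruent = trans (%-cong-+ q c≡s c′≡s′) (trans (cong (_% q) (trans s+s′ (regroup q (x + x) (k * d))))
          (trans ([m+kn]%n≡m%n (x + x + k * d) 1 q)
          (trans (sym ([m+kn]%n≡m%n (x + x + k * d) (4 * t) q)) (cong (_% q) (regroup′ (x + x) (k * d) (4 * t * q))))))
          where
          regroup : ∀ q a r → q + (a + r) ≡ a + r + 1 * q
          regroup = solve-∀
          regroup′ : ∀ a r e → a + r + e ≡ a + e + r
          regroup′ = solve-∀
        conclude : (∃ λ j → b + k * d ≡ value c + value c′ + j * q) →
                   ∃ λ c → (∀ x → c x ≤ 16 * m x) × value c ≡ b + k * d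
        conclude (j , b+kd≡) = (λ y → c y + c′ y + j * ⟦ y ≡ᵇ x₀ ⟧) , bound ,
          trans (weighted-+ q h (λ y → c y + c′ y) _) (trans (cong₂ _+_ (weighted-+ q h c c′)
            (trans (weighted-δ q h j x₀<q) (cong (j *_) h+x₀≡q))) (sym b+kd≡))
          where
          -- `14 = 2 + 4 + 8`, from `x + x`, from the shift in `b` and from `k * d ≤ 8 * q * t`. The
          -- two realised sums raise this to 16.
          j≤14t : j ≤ 14 * t
          j≤14t = *-cancelʳ-≤ j (14 * t) q (begin
            j * q                                  ≤⟨ m≤n+m (j * q) (value c + value c′) ⟩
            value c + value c′ + j * q             ≡⟨ b+kd≡ ⟨
            x + x + 4 * t * q + k * d              ≤⟨ +-mono-≤ (+-monoˡ-≤ (4 * t * q) (+-mono-≤ (<⇒≤ x<q) (<⇒≤ x<q))) (*-mono-≤ k≤8q d≤t) ⟩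
            q + q + 4 * t * q + 8 * q * t          ≡⟨ regroup q t ⟩
            2 * q * 1 + 12 * t * q                 ≤⟨ +-monoˡ-≤ (12 * t * q) (*-monoʳ-≤ (2 * q) 0<t) ⟩
            2 * q * t + 12 * t * q                 ≡⟨ regroup′ q t ⟩
            14 * t * q                             ∎)
            where
            regroup : ∀ q t → q + q + 4 * t * q + 8 * q * t ≡ 2 * q * 1 + 12 * t * q
            regroup = solve-∀
            regroup′ : ∀ q t → 2 * q * t + 12 * t * q ≡ 14 * t * q
            regroup′ = solve-∀
          bound : ∀ y → c y + c′ y + j * ⟦ y ≡ᵇ x₀ ⟧ ≤ 16 * m y
          bound y = begin
            c y + c′ y + j * ⟦ y ≡ᵇ x₀ ⟧   ≤⟨ +-mono-≤ (+-mono-≤ (m≤n⊓o⇒m≤o i (m y) (c≤ y)) (m≤n⊓o⇒m≤o i (m y) (c′≤ y))) copies ⟩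
            m y + m y + 14 * m y           ≡⟨ regroup (m y) ⟩
            16 * m y                       ∎
            where
            regroup : ∀ a → a + a + 14 * a ≡ 16 * a
            regroup = solve-∀
            copies : j * ⟦ y ≡ᵇ x₀ ⟧ ≤ 14 * m y
            copies with y ≡ᵇ x₀ in eq
            ... | false = ≤-trans (≤-reflexive (*-zeroʳ j)) z≤n
            ... | true with refl ← ≡ᵇ⇒≡ y x₀ (subst T (sym eq) tt) = ≤-trans (≤-reflexive (*-identityʳ j)) j≤14t

-- Subset sums of lists

-- Positions are selected, so equal entries count separately; `SubSum-↭` allows free reordering.
data SubSum : List ℕ → ℕ → Set where
  []   : SubSum [] 0
  omit : ∀ {x xs s} → SubSum xs s → SubSum (x ∷ xs) s
  use : ∀ {x xs s} → SubSum xs s → SubSum (x ∷ xs) (x + s)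

SubSum-none : ∀ xs → SubSum xs 0
SubSum-none []       = []
SubSum-none (x ∷ xs) = omit (SubSum-none xs)

SubSum-all : ∀ xs → SubSum xs (sum xs)
SubSum-all []       = []
SubSum-all (x ∷ xs) = use (SubSum-all xs)

SubSum-++ : ∀ {xs ys s t} → SubSum xs s → SubSum ys t → SubSum (xs ++ ys) (s + t)
SubSum-++ []                    q = q
SubSum-++ (omit p)              q = omit (SubSum-++ p q)
SubSum-++ {t = t} (use {x} {s = s} p) q = subst (SubSum _) (sym (+-assoc x s t)) (use (SubSum-++ p q))

SubSum-↭ : ∀ {xs ys s} → xs ↭ ys → SubSum xs s → SubSum ys s
SubSum-↭ refl          p               = p
SubSum-↭ (prep x π)    (omit p)        = omit (SubSum-↭ π p)
SubSum-↭ (prep x π)    (use p)        = use (SubSum-↭ π p)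
SubSum-↭ (swap x y π)  (omit (omit p)) = omit (omit (SubSum-↭ π p))
SubSum-↭ (swap x y π)  (omit (use p)) = use (omit (SubSum-↭ π p))
SubSum-↭ (swap x y π)  (use (omit p)) = omit (use (SubSum-↭ π p))
SubSum-↭ (swap x y π)  (use (use {s = s} p)) =
  subst (SubSum _) (x∙yz≈y∙xz y x s) (use (use (SubSum-↭ π p)))
SubSum-↭ (Perm.trans π₁ π₂) p               = SubSum-↭ π₂ (SubSum-↭ π₁ p)

-- `applyDownFrom` lists the terms in the order in which `subsetSum` recurses, so the indicator is
-- built by overriding one index at a time.
SubSum⇒subsetSum : ∀ a N {s} → SubSum (applyDownFrom a N) s → ∃ λ I → subsetSum a I N ≡ s
SubSum⇒subsetSum a zero    []       = (λ _ → false) , refl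
SubSum⇒subsetSum a (suc N) p        = extend p
  where
  override : Bool → (ℕ → Bool) → ℕ → Bool
  override b I i = if i ≡ᵇ N then b else I i
  override-hit : ∀ b I → override b I N ≡ b
  override-hit b I with N ≡ᵇ N in eq
  ... | true  = refl
  ... | false = ⊥-elim (subst T eq (≡⇒≡ᵇ N N refl))
  override-miss : ∀ b I i → i < N → override b I i ≡ I i
  override-miss b I i i<N with i ≡ᵇ N in eq
  ... | false = refl
  ... | true  = contradiction (≡ᵇ⇒≡ i N (subst T (sym eq) tt)) (<⇒≢ i<N)
  subsetSum-cong : ∀ {I J} n → (∀ i → i < n → I i ≡ J i) → subsetSum a I n ≡ subsetSum a J n
  subsetSum-cong zero    _   = refl
  subsetSum-cong (suc n) I≡J = cong₂ (λ b s → (if b then a n else 0) + s) (I≡J n ≤-refl)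
    (subsetSum-cong n λ i i<n → I≡J i (m<n⇒m<1+n i<n))
  overridden : ∀ b I {s} → subsetSum a I N ≡ s → subsetSum a (override b I) (suc N) ≡ (if b then a N else 0) + s
  overridden b I eq = cong₂ (λ c s → (if c then a N else 0) + s) (override-hit b I)
    (trans (subsetSum-cong N (override-miss b I)) eq)
  extend : ∀ {s} → SubSum (a N ∷ applyDownFrom a N) s → ∃ λ I → subsetSum a I (suc N) ≡ s
  extend (omit p) = let I , eq = SubSum⇒subsetSum a N p in override false I , overridden false I eq
  extend (use p) = let I , eq = SubSum⇒subsetSum a N p in override true  I , overridden true  I eq

multiplicity : (ℕ → ℕ) → ℕ → ℕ → ℕ → ℕ
multiplicity a i₀ n y = ∑ n λ i → ⟦ a (i + i₀) ≡ᵇ y ⟧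

-- Greedy selection from the last term down: a term is used if its value is still in demand, which
-- lowers that demand by one. Terms before index `i₀` are left out.
weighted-SubSum : ∀ a i₀ q h n c → (∀ x → x < q → c x ≤ multiplicity a i₀ n (h + x)) →
                  SubSum (applyDownFrom a (n + i₀)) (weighted q h c)
weighted-SubSum a i₀ q h zero c c≤0 = subst (SubSum _)
  (sym (∑-zero q λ x x<q → cong (_* (h + x)) (n≤0⇒n≡0 (c≤0 x x<q)))) (SubSum-none _)
weighted-SubSum a i₀ q h (suc n) c c≤
  with anyUpTo? (λ x → (h + x ≟ a (n + i₀)) ×-dec (0 <? c x)) q
... | no unused = omit (weighted-SubSum a i₀ q h n c λ x x<q → bound x x<q (c≤ x x<q))
  where
  bound : ∀ x → x < q → c x ≤ ⟦ a (n + i₀) ≡ᵇ h + x ⟧ + multiplicity a i₀ n (h + x) →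
          c x ≤ multiplicity a i₀ n (h + x)
  bound x x<q c≤ with a (n + i₀) ≡ᵇ h + x in eq
  ... | false = c≤
  ... | true  = ≤-trans (≮⇒≥ λ 0<c → unused (x , x<q , sym (≡ᵇ⇒≡ _ _ (subst T (sym eq) tt)) , 0<c)) z≤n
... | yes (k , k<q , h+k≡ , 0<c) = subst (SubSum _) total
        (use (weighted-SubSum a i₀ q h n c′ λ x x<q → bound x (c≤ x x<q)))
  where
  c′ : ℕ → ℕ
  c′ x = c x ∸ ⟦ x ≡ᵇ k ⟧
  bound : ∀ x → c x ≤ ⟦ a (n + i₀) ≡ᵇ h + x ⟧ + multiplicity a i₀ n (h + x) →
          c′ x ≤ multiplicity a i₀ n (h + x)
  bound x c≤ with x ≟ k
  ... | yes refl = m≤n+o⇒m∸n≤o (c x) ⟦ x ≡ᵇ x ⟧ (≤-trans c≤ (+-monoˡ-≤ _ (≤-trans (⟦⟧≤1 (a (n + i₀) ≡ᵇ h + x)) (T⇒1≤⟦⟧ (≡⇒≡ᵇ x x refl)))))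
  ... | no x≢k = ≤-trans (m∸n≤m (c x) ⟦ x ≡ᵇ k ⟧) (subst (λ b → c x ≤ b + multiplicity a i₀ n (h + x))
    (≢⇒⟦≡ᵇ⟧≡0 λ eq → x≢k (+-cancelˡ-≡ h x k (trans (sym eq) (sym h+k≡)))) c≤)
  restore : ∀ x → 1 * ⟦ x ≡ᵇ k ⟧ + c′ x ≡ c x
  restore x with x ≡ᵇ k in eq
  ... | false = refl
  ... | true with refl ← ≡ᵇ⇒≡ x k (subst T (sym eq) tt) = m+[n∸m]≡n 0<c
  total : a (n + i₀) + weighted q h c′ ≡ weighted q h c
  total = begin
    a (n + i₀) + weighted q h c′                          ≡⟨ cong (_+ weighted q h c′) (trans (*-identityˡ (h + k)) h+k≡) ⟨
    1 * (h + k) + weighted q h c′                         ≡⟨ cong (_+ weighted q h c′) (weighted-δ q h 1 k<q) ⟨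
    weighted q h (λ x → 1 * ⟦ x ≡ᵇ k ⟧) + weighted q h c′ ≡⟨ weighted-+ q h (λ x → 1 * ⟦ x ≡ᵇ k ⟧) c′ ⟨
    weighted q h (λ x → 1 * ⟦ x ≡ᵇ k ⟧ + c′ x)            ≡⟨ ∑-cong q (λ x → cong (_* (h + x)) (restore x)) ⟩
    weighted q h c                                        ∎
    where open ≡-Reasoning

-- Two of the `d + 1` prefix sums agree modulo `d`, and the block between them is the one sought.
zero-sum-block : ∀ d .{{_ : NonZero d}} xs → length xs ≡ d →
  ∃ λ ys → ∃ λ zs → ∃ λ ws → xs ≡ ys ++ zs ++ ws × 0 < length zs × ∃ λ j → sum zs ≡ j * d
zero-sum-block d xs refl with pigeonhole ≤-refl residue
  where
  residue : Fin (suc d) → Fin d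
  residue i = fromℕ< (m%n<n (sum (take (toℕ i) xs)) d)
... | i , j , i<j , same =
  let l = toℕ j ∸ toℕ i
      k , eq = ≡-%⇒+* d {sum (take (toℕ i) xs)} {sum (take (toℕ j) xs)}
        (subst (sum (take (toℕ i) xs) ≤_) (sym (prefix-sum i<j)) (m≤m+n _ _))
        (trans (sym (toℕ-fromℕ< _)) (trans (cong toℕ same) (toℕ-fromℕ< _)))
  in  take (toℕ i) xs , take l (drop (toℕ i) xs) , drop l (drop (toℕ i) xs) ,
      sym (trans (cong (take (toℕ i) xs ++_) (take++drop≡id l (drop (toℕ i) xs))) (take++drop≡id (toℕ i) xs)) ,
      nonempty i<j , k , +-cancelˡ-≡ (sum (take (toℕ i) xs)) _ _ (trans (sym (prefix-sum i<j)) eq)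
  where
  take-split : ∀ i l (xs : List ℕ) → take (i + l) xs ≡ take i xs ++ take l (drop i xs)
  take-split zero    l       xs       = refl
  take-split (suc i) zero    []       = refl
  take-split (suc i) (suc l) []       = refl
  take-split (suc i) l       (x ∷ xs) = cong (x ∷_) (take-split i l xs)
  prefix-sum : ∀ {i j} → i < j → sum (take j xs) ≡ sum (take i xs) + sum (take (j ∸ i) (drop i xs))
  prefix-sum {i} {j} i<j = trans (cong (λ k → sum (take k xs)) (sym (m+[n∸m]≡n (<⇒≤ i<j))))
    (trans (cong sum (take-split i (j ∸ i) xs)) (sum-++ (take i xs) _))
  nonempty : toℕ i < toℕ j → 0 < length (take (toℕ j ∸ toℕ i) (drop (toℕ i) xs))
  nonempty i<j = subst (0 <_) (sym (trans (length-take (toℕ j ∸ toℕ i) (drop (toℕ i) xs)) (cong ((toℕ j ∸ toℕ i) ⊓_) (length-drop (toℕ i) xs))))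
    (⊓-glb (m<n⇒0<n∸m i<j) (m<n⇒0<n∸m (<-≤-trans i<j (s≤s⁻¹ (toℕ<n j)))))

-- Absorption of the later terms

sum≤length* : ∀ {e} xs → All (_≤ e) xs → sum xs ≤ length xs * e
sum≤length* []       []         = z≤n
sum≤length* (x ∷ xs) (x≤e ∷ xs≤e) = +-mono-≤ x≤e (sum≤length* xs xs≤e)

module Absorption (a : ℕ → ℕ) (a-mono : NonDecreasing a) (n₀ b d L₀ : ℕ) .{{_ : NonZero d}}
  (initial : ∀ k → k ≤ L₀ → SubSum (applyDownFrom a n₀) (b + k * d))
  (d≤2a : ∀ p → d ≤ 2 * a (p + n₀)) (4a≤ : ∀ p → 4 * a (p + n₀) ≤ 2 * L₀ + p) where

  -- Terms wait in `pending` until there are `d` of them, and then a block of sum divisible by `d`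
  -- moves to `used`. The potential `d * L + sum pending` in `long` gains at least `d / 2` with each
  -- term and is unchanged by a move.
  record State (p : ℕ) : Set where
    field
      used pending : List ℕ
      L            : ℕ
      arrangement  : applyDownFrom a (p + n₀) ↭ used ++ pending
      few          : length pending < d
      bounded      : All (_≤ a (p + n₀)) pending
      progression  : ∀ k → k ≤ L → SubSum used (b + k * d)
      long         : d * (2 * L₀ + p) ≤ 2 * (d * L + sum pending)

    pending-sum : sum pending ≤ d * a (p + n₀)
    pending-sum = ≤-trans (sum≤length* pending bounded) (*-monoˡ-≤ (a (p + n₀)) (<⇒≤ few))

    -- The pending terms can withhold at most `a (p + n₀)` from the length, being fewer than `d` and
    -- each of at most that size.
    length-bound : 2 * L₀ + p ≤ 2 * (L + a (p + n₀))
    length-bound = *-cancelˡ-≤ d (begin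
      d * (2 * L₀ + p)                        ≤⟨ long ⟩
      2 * (d * L + sum pending)               ≤⟨ *-monoʳ-≤ 2 (+-monoʳ-≤ (d * L) pending-sum) ⟩
      2 * (d * L + d * a (p + n₀))            ≡⟨ regroup d L (a (p + n₀)) ⟩
      d * (2 * (L + a (p + n₀)))              ∎)
      where
      open ≤-Reasoning
      regroup : ∀ d l e → 2 * (d * l + d * e) ≡ d * (2 * (l + e))
      regroup = solve-∀

    -- This leaves no hole when a block is absorbed: the sum of `d` terms of size at most
    -- `a (p + n₀)` is then at most `d * L`.
    next≤L : a (p + n₀) ≤ L
    next≤L = *-cancelˡ-≤ 2 (+-cancelʳ-≤ (2 * a (p + n₀)) _ _ (begin
      2 * a (p + n₀) + 2 * a (p + n₀)   ≡⟨ regroup (a (p + n₀)) ⟩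
      4 * a (p + n₀)                    ≤⟨ 4a≤ p ⟩
      2 * L₀ + p                        ≤⟨ length-bound ⟩
      2 * (L + a (p + n₀))              ≡⟨ *-distribˡ-+ 2 L _ ⟩
      2 * L + 2 * a (p + n₀)            ∎))
      where
      open ≤-Reasoning
      regroup : ∀ e → 2 * e + 2 * e ≡ 4 * e
      regroup = solve-∀

    -- The length tends to infinity, so term `k` of the progression is available at stage `4 * k`.
    p≤4L : p ≤ 4 * L
    p≤4L = ≤-trans (m≤n+m p (2 * L₀)) (+-cancelˡ-≤ (2 * L₀ + p) _ _ (begin
      (2 * L₀ + p) + (2 * L₀ + p)               ≤⟨ +-mono-≤ length-bound length-bound ⟩
      2 * (L + e) + 2 * (L + e)                 ≡⟨ regroup L e ⟩
      4 * e + 4 * L                             ≤⟨ +-monoˡ-≤ (4 * L) (4a≤ p) ⟩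
      2 * L₀ + p + 4 * L                        ∎))
      where
      open ≤-Reasoning
      e = a (p + n₀)
      regroup : ∀ l e → 2 * (l + e) + 2 * (l + e) ≡ 4 * e + 4 * l
      regroup = solve-∀

  open State

  state : ∀ p → State p
  state zero = record
    { used = applyDownFrom a n₀ ; pending = [] ; L = L₀
    ; arrangement = ↭-sym (↭.++-identityʳ _)
    ; few = >-nonZero⁻¹ d
    ; bounded = []
    ; progression = initial
    ; long = ≤-reflexive (regroup d L₀) }
    where
    regroup : ∀ d l → d * (2 * l + 0) ≡ 2 * (d * l + 0)
    regroup = solve-∀
  state (suc p) = absorb (m≤n⇒m<n∨m≡n (few st))
    where
    st = state p
    U = used st
    P = pending st
    ℓ = L st
    e = a (p + n₀)
    P′ = e ∷ P

    arrangement′ : applyDownFrom a (suc p + n₀) ↭ U ++ P′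
    arrangement′ = ↭-trans (prep e (arrangement st)) (↭-sym (↭.shift e U P))

    bounded-e : All (_≤ e) P′
    bounded-e = ≤-refl ∷ bounded st

    bounded′ : All (_≤ a (suc p + n₀)) P′
    bounded′ = All.map (λ x≤e → ≤-trans x≤e (a-mono _ _ (n≤1+n (p + n₀)))) bounded-e

    long′ : d * (2 * L₀ + suc p) ≤ 2 * (d * ℓ + sum P′)
    long′ = begin
      d * (2 * L₀ + suc p)                 ≡⟨ regroup d L₀ p ⟩
      d * (2 * L₀ + p) + d                 ≤⟨ +-mono-≤ (long st) (d≤2a p) ⟩
      2 * (d * ℓ + sum P) + 2 * e          ≡⟨ regroup′ (d * ℓ) (sum P) e ⟩
      2 * (d * ℓ + sum P′)                 ∎
      where
      open ≤-Reasoning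
      regroup : ∀ d l p → d * (2 * l + suc p) ≡ d * (2 * l + p) + d
      regroup = solve-∀
      regroup′ : ∀ a b c → 2 * (a + b) + 2 * c ≡ 2 * (a + (c + b))
      regroup′ = solve-∀

    absorb : length P′ < d ⊎ length P′ ≡ d → State (suc p)
    absorb (inj₁ few′) = record
      { used = U ; pending = P′ ; L = ℓ
      ; arrangement = arrangement′ ; few = few′ ; bounded = bounded′
      ; progression = progression st ; long = long′ }
    -- A block of sum `j * d` lengthens the progression by `j` steps.
    absorb (inj₂ full) with ys , zs , ws , P′≡ , 0<zs , j , sum-zs ← zero-sum-block d P′ full = record
      { used = zs ++ U ; pending = ys ++ ws ; L = ℓ + j
      ; arrangement = ↭-trans arrangement′ (↭-trans (↭.++⁺ˡ U (↭-trans (↭-reflexive P′≡) (↭.shifts ys zs)))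
          (↭-trans (↭-reflexive (sym (++-assoc U zs (ys ++ ws)))) (↭.++⁺ʳ (ys ++ ws) (↭.++-comm U zs))))
      ; few = few″
      ; bounded = bounded″
      ; progression = progression″
      ; long = subst (d * (2 * L₀ + suc p) ≤_) (cong (2 *_) sums) long′ }
      where
      open ≤-Reasoning
      lengths : length ys + (length zs + length ws) ≡ d
      lengths = trans (sym (trans (length-++ ys) (cong (length ys +_) (length-++ zs))))
        (trans (cong length (sym P′≡)) full)
      few″ : length (ys ++ ws) < d
      few″ = begin-strict
        length (ys ++ ws)                        ≡⟨ length-++ ys ⟩
        length ys + length ws                    <⟨ +-monoʳ-< (length ys) (m<n+m (length ws) 0<zs) ⟩
        length ys + (length zs + length ws)      ≡⟨ lengths ⟩
        d                                        ∎
      bounded″ : All (_≤ a (suc p + n₀)) (ys ++ ws)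
      bounded″ = let ys≤ , rest = ++⁻ ys (subst (All _) P′≡ bounded′)
                 in  ++⁺ ys≤ (proj₂ (++⁻ zs rest))
      P′-sum : sum P′ ≡ sum ys + (sum zs + sum ws)
      P′-sum = trans (cong sum P′≡) (trans (sum-++ ys _) (cong (sum ys +_) (sum-++ zs ws)))
      j≤ℓ : j ≤ ℓ
      j≤ℓ = *-cancelʳ-≤ j ℓ d (begin
        j * d                                    ≡⟨ sum-zs ⟨
        sum zs                                   ≤⟨ m≤m+n (sum zs) (sum ws) ⟩
        sum zs + sum ws                          ≤⟨ m≤n+m _ (sum ys) ⟩
        sum ys + (sum zs + sum ws)               ≡⟨ P′-sum ⟨
        sum P′                                   ≤⟨ sum≤length* P′ bounded-e ⟩
        length P′ * e                            ≡⟨ trans (cong (_* e) full) (*-comm d e) ⟩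
        e * d                                    ≤⟨ *-monoˡ-≤ d (next≤L st) ⟩
        ℓ * d                                    ∎)
      sums : d * ℓ + sum P′ ≡ d * (ℓ + j) + sum (ys ++ ws)
      sums = trans (cong (d * ℓ +_) (trans P′-sum (cong (λ s → sum ys + (s + sum ws)) sum-zs)))
        (trans (regroup d ℓ j (sum ys) (sum ws)) (cong (d * (ℓ + j) +_) (sym (sum-++ ys ws))))
        where
        regroup : ∀ d l j y w → d * l + (y + (j * d + w)) ≡ d * (l + j) + (y + w)
        regroup = solve-∀
      progression″ : ∀ k → k ≤ ℓ + j → SubSum (zs ++ U) (b + k * d)
      progression″ k k≤ with k ≤? ℓ
      ... | yes k≤ℓ = SubSum-++ (SubSum-none zs) (progression st k k≤ℓ)
      -- Here `j ≤ ℓ < k`, so the whole block is added to the old representation for `k ∸ j`.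
      ... | no  k≰ℓ = subst (SubSum _) shifted
              (SubSum-++ (SubSum-all zs) (progression st (k ∸ j) (m≤n+o⇒m∸n≤o k j (≤-trans k≤ (≤-reflexive (+-comm ℓ j))))))
        where
        regroup : ∀ j d b k → j * d + (b + k * d) ≡ b + (j + k) * d
        regroup = solve-∀
        shifted : sum zs + (b + (k ∸ j) * d) ≡ b + k * d
        shifted = trans (cong (_+ (b + (k ∸ j) * d)) sum-zs) (trans (regroup j d b (k ∸ j))
          (cong (λ k → b + k * d) (m+[n∸m]≡n (≤-trans j≤ℓ (<⇒≤ (≰⇒> k≰ℓ))))))

  infinite-progression : ∀ k → InSubsetSums a (b + k * d)
  infinite-progression k = 4 * k + n₀ , SubSum⇒subsetSum a (4 * k + n₀)
    (SubSum-↭ (↭-sym (arrangement st)) (subst (SubSum _) (+-identityʳ _)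
      (SubSum-++ (progression st k (*-cancelˡ-≤ 4 (p≤4L st))) (SubSum-none (pending st)))))
    where
    st = state (4 * k)

-- The dense block

argmax : ∀ n (f : ℕ → ℕ) → 0 < n → ∃ λ k → k < n × ∀ x → x < n → f x ≤ f k
argmax (suc zero)    f _ = 0 , ≤-refl , λ { zero _ → ≤-refl ; (suc x) (s≤s ()) }
argmax (suc (suc n)) f _ with k , k<1+n , f≤ ← argmax (suc n) f z<s with f k ≤? f (suc n)
... | yes fk≤ = suc n , ≤-refl , λ x x<2+n → case (m≤n⇒m<n∨m≡n (s≤s⁻¹ x<2+n))
  where
  case : ∀ {x} → x < suc n ⊎ x ≡ suc n → f x ≤ f (suc n)
  case (inj₁ x<1+n) = ≤-trans (f≤ _ x<1+n) fk≤
  case (inj₂ refl)  = ≤-refl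
... | no fk≰ = k , m<n⇒m<1+n k<1+n , λ x x<2+n → case (m≤n⇒m<n∨m≡n (s≤s⁻¹ x<2+n))
  where
  case : ∀ {x} → x < suc n ⊎ x ≡ suc n → f x ≤ f k
  case (inj₁ x<1+n) = f≤ _ x<1+n
  case (inj₂ refl)  = <⇒≤ (≰⇒> fk≰)

countBelow≤N : ∀ a n N → countBelow a n N ≤ N
countBelow≤N a n zero    = z≤n
countBelow≤N a n (suc N) = +-mono-≤ (⟦⟧≤1 (a N ≤ᵇ n)) (countBelow≤N a n N)

countBelow≤ : ∀ a → NonDecreasing a → ∀ n {M} → n < a M → ∀ N → countBelow a n N ≤ M
countBelow≤ a a-mono n n<aM zero = z≤n
countBelow≤ a a-mono n {M} n<aM (suc N) with a N ≤ᵇ n in eq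
... | false = countBelow≤ a a-mono n n<aM N
... | true  = ≤-trans (s≤s (countBelow≤N a n N)) (≰⇒> λ M≤N →
  <⇒≱ (<-≤-trans n<aM (a-mono M N M≤N)) (≤ᵇ⇒≤ (a N) n (subst T (sym eq) tt)))

-- If `a (C * n)` exceeded `n`, only indices below `C * n` would be counted; the additional `n` in
-- `suc C * n` contradicts this.
term-bound : ∀ a → NonDecreasing a → ∀ C n → 0 < n → CountingAtLeast a n (suc C * n) → a (C * n) ≤ n
term-bound a a-mono C n 0<n (N , large) = ≮⇒≥ λ n<a → <⇒≱ (m<n+m (C * n) 0<n)
  (≤-trans large (countBelow≤ a a-mono n n<a N))

n≤2^n : ∀ n → n ≤ 2 ^ n
n≤2^n zero    = z≤n
n≤2^n (suc n) = +-mono-≤ (m^n>0 2 n) (≤-trans (n≤2^n n) (≤-reflexive (sym (+-identityʳ (2 ^ n)))))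

module DenseBlock (a : ℕ → ℕ) (positive : Positive a) (a-mono : NonDecreasing a)
  (F u : ℕ) (702<F : 702 < F) (block-large : u < 2 * a (F * u)) (block-small : a (F * u + F * u) ≤ u) where

  i₀ N h : ℕ
  i₀ = F * u
  N  = F * u
  h  = a i₀

  in-block : ∀ i → i < N → h ≤ a (i + i₀) × a (i + i₀) ≤ u
  in-block i i<N = a-mono _ _ (m≤n+m i₀ i) , ≤-trans (a-mono _ _ (+-monoˡ-≤ i₀ (<⇒≤ i<N))) block-small

  -- Of the 16 copies per layer, one is used in each summand of S i + S i, and 14 copies of q
  -- fill up the residues to a progression.
  m : ℕ → ℕ
  m x = multiplicity a i₀ N (h + x) / 16

  u<2h : u < 2 * h
  u<2h = block-large

  -- Values from `2 * h` on exceed `u` and do not occur in the block. Hence a maximum over `x < h`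
  -- is one over all `x < q`.
  m-support : ∀ x → h ≤ x → m x ≡ 0
  m-support x h≤x = cong (_/ 16) (∑-zero N λ i i<N → ≢⇒⟦≡ᵇ⟧≡0 λ eq → <⇒≱ u<2h (begin
    h + (h + 0)     ≡⟨ cong (h +_) (+-identityʳ h) ⟩
    h + h           ≤⟨ +-monoʳ-≤ h h≤x ⟩
    h + x           ≡⟨ eq ⟨
    a (i + i₀)      ≤⟨ proj₂ (in-block i i<N) ⟩
    u               ∎))
    where open ≤-Reasoning

  private
    peak : ∃ λ k → k < h × ∀ x → x < h → m x ≤ m k
    peak = argmax h m (positive i₀)

  x₀ q : ℕ
  x₀ = proj₁ peak
  q  = h + x₀

  instance
    q≢0 : NonZero q
    q≢0 = >-nonZero (≤-trans (positive i₀) (m≤m+n h x₀))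

  h≤q : h ≤ q
  h≤q = m≤m+n h x₀

  m≤mx₀ : ∀ x → x < q → m x ≤ m x₀
  m≤mx₀ x _ with x <? h
  ... | yes x<h = proj₂ (proj₂ peak) x x<h
  ... | no  x≮h = subst (_≤ m x₀) (sym (m-support x (≮⇒≥ x≮h))) z≤n

  q≤2h : q ≤ 2 * h
  q≤2h = subst (q ≤_) (cong (h +_) (sym (+-identityʳ h))) (+-monoʳ-≤ h (<⇒≤ (proj₁ (proj₂ peak))))

  h≤u : h ≤ u
  h≤u = ≤-trans (a-mono _ _ (m≤m+n (F * u) (F * u))) block-small

  -- Division by 16 loses at most 15 for each of the `q` values, and `16 * 21 + 15 = 351`. Since
  -- `q ≤ 2 * u`, a block of more than `702 * u` terms suffices.
  many : 21 * q < ∑ q m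
  many = *-cancelˡ-< 16 _ _ (+-cancelʳ-< (15 * q) _ _ (begin-strict
    16 * (21 * q) + 15 * q                                        ≡⟨ regroup q ⟩
    351 * q                                                       ≤⟨ *-monoʳ-≤ 351 (≤-trans q≤2h (*-monoʳ-≤ 2 h≤u)) ⟩
    351 * (2 * u)                                                 ≡⟨ *-assoc 351 2 u ⟨
    702 * u                                                       <⟨ *-monoˡ-< u {{>-nonZero (≤-trans (positive i₀) h≤u)}} 702<F ⟩
    N                                                             ≡⟨ trans (∑-const N 1) (*-identityʳ N) ⟨
    ∑ N (λ _ → 1)                                                 ≤⟨ ∑-mono N hit ⟩
    ∑ N (λ i → ∑ q (λ x → ⟦ a (i + i₀) ≡ᵇ h + x ⟧))               ≡⟨ ∑-swap N q _ ⟩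
    ∑ q (λ x → multiplicity a i₀ N (h + x))                       ≤⟨ ∑-mono q (λ x _ → floor (multiplicity a i₀ N (h + x))) ⟩
    ∑ q (λ x → 16 * m x + 15)                                     ≡⟨ ∑-+ q (λ x → 16 * m x) (λ _ → 15) ⟩
    ∑ q (λ x → 16 * m x) + ∑ q (λ _ → 15)                         ≡⟨ cong₂ _+_ (∑-* q 16 m) (trans (∑-const q 15) (*-comm q 15)) ⟩
    16 * ∑ q m + 15 * q                                           ∎))
    where
    open ≤-Reasoning
    regroup : ∀ q → 16 * (21 * q) + 15 * q ≡ 351 * q
    regroup = solve-∀
    hit : ∀ i → i < N → 1 ≤ ∑ q (λ x → ⟦ a (i + i₀) ≡ᵇ h + x ⟧)
    hit i i<N = ≤-trans (T⇒1≤⟦⟧ (≡⇒≡ᵇ (a (i + i₀)) _ (sym (m+[n∸m]≡n h≤a))))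
      (term≤∑ q (λ x → ⟦ a (i + i₀) ≡ᵇ h + x ⟧) (<-≤-trans offset h≤q))
      where
      h≤a = proj₁ (in-block i i<N)
      offset : a (i + i₀) ∸ h < h
      offset = +-cancelˡ-< h _ _ (begin-strict
        h + (a (i + i₀) ∸ h)   ≡⟨ m+[n∸m]≡n h≤a ⟩
        a (i + i₀)             ≤⟨ proj₂ (in-block i i<N) ⟩
        u                      <⟨ u<2h ⟩
        h + (h + 0)            ≡⟨ cong (h +_) (+-identityʳ h) ⟩
        h + h                  ∎)
    floor : ∀ n → n ≤ 16 * (n / 16) + 15
    floor n = begin
      n                        ≡⟨ m≡m%n+[m/n]*n n 16 ⟩
      n % 16 + n / 16 * 16     ≤⟨ +-monoˡ-≤ _ (s≤s⁻¹ (m%n<n n 16)) ⟩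
      15 + n / 16 * 16         ≡⟨ trans (+-comm 15 _) (cong (_+ 15) (*-comm (n / 16) 16)) ⟩
      16 * (n / 16) + 15       ∎

  -- The division by 16 in `m` guarantees that the `16 * m x` copies are present, and
  -- `u < 2 * h ≤ 2 * q` makes the length `8 * q` cover `4 * u`.
  block-progression : ∃ λ b → ∃ λ d → 0 < d × d ≤ 2 * h ×
    ∀ k → k ≤ 4 * u → SubSum (applyDownFrom a (N + i₀)) (b + k * d)
  block-progression =
    let b , d , 0<d , d≤q , members = Layers.progression q h h≤q m x₀ (m<n+m x₀ (positive i₀)) refl m≤mx₀ many
    in  b , d , 0<d , ≤-trans d≤q q≤2h , λ k k≤4u →
        let c , c≤ , total = members k (≤-trans k≤4u 4u≤8q)
        in  subst (SubSum _) total (weighted-SubSum a i₀ q h N c λ x _ →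
              ≤-trans (c≤ x) (≤-trans (≤-reflexive (*-comm 16 (m x))) (m/n*n≤m _ 16)))
    where
    4u≤8q : 4 * u ≤ 8 * q
    4u≤8q = ≤-trans (*-monoʳ-≤ 4 (≤-trans (<⇒≤ u<2h) (*-monoʳ-≤ 2 h≤q))) (≤-reflexive (sym (*-assoc 4 2 q)))

-- Choice of the scale and the constant

module _ (K : ℕ) .{{_ : NonZero K}} (702<4K : 702 < 4 * K) (a : ℕ → ℕ) (positive : Positive a) (a-mono : NonDecreasing a) where

  F : ℕ
  F = 4 * K

  Dense : ℕ → Set
  Dense i = a (2 * F * 2 ^ i) ≤ 2 ^ i

  -- Descent to the earliest scale. Failure of density one scale below is the required lower bound
  -- for the first term of the block; at scale `1` positivity gives it.
  first-dense : ∀ i → (∀ j → i ≤ j → Dense j) →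
                ∃ λ i → (∀ j → i ≤ j → Dense j) × 2 ^ i < 2 * a (F * 2 ^ i)
  first-dense zero    dense = 0 , dense , *-monoʳ-≤ 2 (positive (F * 1))
  first-dense (suc i) dense with a (2 * F * 2 ^ i) ≤? 2 ^ i
  ... | yes dense-i = first-dense i λ j i≤j → case (m≤n⇒m<n∨m≡n i≤j)
    where
    case : ∀ {j} → i < j ⊎ i ≡ j → Dense j
    case (inj₁ i<j)  = dense _ i<j
    case (inj₂ refl) = dense-i
  ... | no ¬dense-i = suc i , dense ,
    *-monoʳ-< 2 (subst (λ n → 2 ^ i < a n) (regroup F (2 ^ i)) (≰⇒> ¬dense-i))
    where
    regroup : ∀ f n → 2 * f * n ≡ f * (2 * n)
    regroup = solve-∀

  subcomplete : ∀ i → (∀ j → i ≤ j → Dense j) → 2 ^ i < 2 * a (F * 2 ^ i) → Subcomplete a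
  subcomplete i dense large =
    let b , d , 0<d , d≤2h , initial = block-progression
    in  b , d , 0<d , Absorption.infinite-progression a a-mono n₀ b d (4 * u) {{>-nonZero 0<d}} initial
          (λ p → ≤-trans d≤2h (*-monoʳ-≤ 2 (a-mono _ _ (≤-trans (m≤n+m (F * u) (F * u)) (m≤n+m n₀ p)))))
          4a≤
    where
    u n₀ : ℕ
    u  = 2 ^ i
    n₀ = F * u + F * u
    n₀≡ : 2 * F * u ≡ n₀
    n₀≡ = double F u
      where
      double : ∀ f u → 2 * f * u ≡ f * u + f * u
      double = solve-∀
    open DenseBlock a positive a-mono F u 702<4K large (subst (λ n → a n ≤ u) n₀≡ (dense i ≤-refl))
    open ≤-Reasoning
    -- The scale doubles only when the index `p + n₀` has reached `2 * F * 2 ^ j`, so `2 ^ j` grows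
    -- at most linearly in `p`.
    scale : ∀ p → ∃ λ j → i ≤ j × p + n₀ ≤ 2 * F * 2 ^ j × 4 * 2 ^ j ≤ 2 * (4 * u) + p
    scale zero = i , ≤-refl , ≤-reflexive (sym n₀≡) ,
      ≤-trans (m≤m+n (4 * u) (4 * u + 0)) (≤-reflexive (sym (+-identityʳ (2 * (4 * u)))))
    scale (suc p) with j , i≤j , fits , tight ← scale p with p + n₀ <? 2 * F * 2 ^ j
    ... | yes p+n₀< = j , i≤j , p+n₀< , ≤-trans tight (+-monoʳ-≤ (2 * (4 * u)) (n≤1+n p))
    ... | no  p+n₀≮ = suc j , m≤n⇒m≤1+n i≤j , fits′ , ≤-trans tight′ (+-monoʳ-≤ (2 * (4 * u)) (n≤1+n p))
      where
      instance
        F≢0 : NonZero (2 * F)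
        F≢0 = m*n≢0 2 F {{_}} {{m*n≢0 4 K}}
      fits′ : suc p + n₀ ≤ 2 * F * 2 ^ suc j
      fits′ = begin
        1 + (p + n₀)                           ≤⟨ +-mono-≤ (*-mono-≤ (>-nonZero⁻¹ (2 * F)) (m^n>0 2 j)) fits ⟩
        2 * F * 2 ^ j + 2 * F * 2 ^ j          ≡⟨ double (2 * F) (2 ^ j) ⟩
        2 * F * 2 ^ suc j                      ∎
        where
        double : ∀ f n → f * n + f * n ≡ f * (2 * n)
        double = solve-∀
      -- Since `2 * F = 8 * K`, dividing the threshold by `K` gives `8 * 2 ^ j`; this is why `F` is
      -- taken as a multiple of 4.
      tight′ : 4 * 2 ^ suc j ≤ 2 * (4 * u) + p
      tight′ = *-cancelˡ-≤ K (begin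
        K * (4 * (2 * 2 ^ j))          ≡⟨ regroup K (2 ^ j) ⟩
        2 * F * 2 ^ j                  ≤⟨ ≮⇒≥ p+n₀≮ ⟩
        p + n₀                         ≡⟨ regroup′ K u p ⟩
        K * (2 * (4 * u)) + p          ≤⟨ +-monoʳ-≤ (K * (2 * (4 * u))) (m≤n*m p K) ⟩
        K * (2 * (4 * u)) + K * p      ≡⟨ *-distribˡ-+ K (2 * (4 * u)) p ⟨
        K * (2 * (4 * u) + p)          ∎)
        where
        regroup : ∀ k n → k * (4 * (2 * n)) ≡ 2 * (4 * k) * n
        regroup = solve-∀
        regroup′ : ∀ k u p → p + (4 * k * u + 4 * k * u) ≡ k * (2 * (4 * u)) + p
        regroup′ = solve-∀
    4a≤ : ∀ p → 4 * a (p + n₀) ≤ 2 * (4 * u) + p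
    4a≤ p with j , i≤j , fits , tight ← scale p =
      ≤-trans (*-monoʳ-≤ 4 (≤-trans (a-mono _ _ fits) (dense j i≤j))) tight

theorem6p3 : ∃[ C ] ((a : ℕ → ℕ) → Positive a → NonDecreasing a →
    (∃[ n₀ ] (∀ n → n₀ ≤ n → CountingAtLeast a n (C * n))) →
    Subcomplete a)
-- `704 = 4 * 176` is the least multiple of 4 above 702. `Dense` needs twice that density, and `suc`
-- is the slack used in `term-bound`.
theorem6p3 = suc (2 * (4 * 176)) , λ a positive a-mono (n₀ , dense) →
  let i , dense-i , large = first-dense 176 702<704 a positive a-mono n₀ λ j n₀≤j →
        term-bound a a-mono (2 * (4 * 176)) (2 ^ j) (m^n>0 2 j)
          (dense (2 ^ j) (≤-trans n₀≤j (n≤2^n j)))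
  in  subcomplete 176 702<704 a positive a-mono i dense-i large
  where
  702<704 : 702 < 4 * 176
  702<704 = from-yes (702 <? 704)
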